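{- Let $n\equiv 1 \pmod 4$, let $p>0$ be an integer, and suppose $n\geq 4p+3$. Then there exists a globally simple integer Heffter array $H(n;4p+3)$.
   Context: A Heffter array $H(n;k)$ is an $n\times n$ array of integers (some cells may be empty) such that: each row and each column contains exactly $k$ filled cells; the entries in every row and every column sum to $0$ modulo $2nk+1$; and for each integer $1\leq x\leq nk$, either $x$ or $-x$ appears in the array. It is an integer Heffter array if every row sum and every column sum is $0$ in $\mathbb{Z}$. Rows and columns are indexed by $0,1,\dots,n-1$. The natural ordering of a row lists its filled cells from left to right (increasing column index), and that of a column from top to bottom (increasing row index). The array is globally simple if, for every row and every column, writing its entries in natural order as $a_0,\dots,a_{k-1}$, the partial sums $\sum_{j=0}^{i}a_j$, $i=0,\dots,k-1$, are pairwise distinct modulo $2nk+1$. -}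

module Defs where

open import Data.Nat as ℕ using (ℕ; suc; NonZero)
open import Data.Integer as ℤ using (ℤ; +_; -_; _+_)
open import Data.Integer.DivMod using (_%ℕ_)
open import Data.Fin using (Fin)
open import Data.List using (List; []; _∷_; map; catMaybes; length; foldr; allFin)
open import Data.List.Relation.Unary.Unique.Propositional using (Unique)
open import Data.Maybe using (Maybe; just)
open import Data.Product using (_×_; ∃-syntax)
open import Data.Sum using (_⊎_)
open import Relation.Binary.PropositionalEquality using (_≡_)

-- A partially filled n×n array of integers: `nothing` = empty cell.
Array : ℕ → Set
Array n = Fin n → Fin n → Maybe ℤ

rowEntries : ∀ {n} → Array n → Fin n → List ℤ
rowEntries {n} A i = catMaybes (map (λ j → A i j) (allFin n))

colEntries : ∀ {n} → Array n → Fin n → List ℤ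
colEntries {n} A j = catMaybes (map (λ i → A i j) (allFin n))

sumℤ : List ℤ → ℤ
sumℤ = foldr _+_ (+ 0)

partialSums : List ℤ → List ℤ
partialSums = go (+ 0)
  where
  go : ℤ → List ℤ → List ℤ
  go s [] = []
  go s (x ∷ xs) = (s + x) ∷ go (s + x) xs

IsIntegerHeffter : (n k : ℕ) → Array n → Set
IsIntegerHeffter n k A =
  (∀ i → length (rowEntries A i) ≡ k) ×
  (∀ j → length (colEntries A j) ≡ k) ×
  (∀ i → sumℤ (rowEntries A i) ≡ + 0) ×
  (∀ j → sumℤ (colEntries A j) ≡ + 0) ×
  (∀ (x : ℕ) → 1 ℕ.≤ x → x ℕ.≤ n ℕ.* k →
     ∃[ i ] ∃[ j ] (A i j ≡ just (+ x) ⊎ A i j ≡ just (- (+ x))))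

SimpleMod : (m : ℕ) → .{{NonZero m}} → List ℤ → Set
SimpleMod m xs = Unique (map (λ s → s %ℕ m) (partialSums xs))

IsGloballySimple : (n k : ℕ) → Array n → Set
IsGloballySimple n k A =
  (∀ i → SimpleMod (suc (2 ℕ.* n ℕ.* k)) (rowEntries A i)) ×
  (∀ j → SimpleMod (suc (2 ℕ.* n ℕ.* k)) (colEntries A j))

{-# OPTIONS --safe #-}
module Submission where

-- Write n = 4q + 1 and index the cells of row i by the diagonal d = j - i (mod n).
--
-- Diagonals 0, 1 and u = (n + 1)/2 carry 1, …, 3n.  As 2u ≡ 1 (mod n), a function α on ℤ/n and a
-- constant K give zero row and column sums through the entries α(i), α(i + u) - K and
-- K - α(i) - α(j).  With K = 4n + 1 and α read off a graceful labelling of the path on n vertices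
-- whose end labels add up to n + 1, the first two diagonals contain n + 1, …, 3n and the third
-- one 1, …, n, up to sign.
--
-- The numbers above 3n fill p pairs of diagonals between 1 and u and p pairs after u.  A pair
-- before u contributes x, -x - D to a line, a pair after u contributes -y, y + D, with the same D
-- for all pairs of that line, so the pairs cancel.  In increasing order the partial sums are: the
-- sums inside the pairs after u, the sums between pairs, and then the first entry followed by the
-- sums inside the pairs before u.  They are distinct and spread over less than 2nk + 1, hence
-- distinct modulo 2nk + 1, which for a zero-sum line depends neither on the entry where it starts
-- nor on its direction.

open import Defs

-- Partial sums of a list and their congruences.

module PartialSums where

  open import Data.Nat as ℕ using (ℕ; NonZero)
  open import Data.Integer hiding (NonZero)
  open import Data.Integer.Properties
  open import Data.Integer.DivMod using (_%ℕ_; _/ℕ_; a≡a%ℕn+[a/ℕn]*n)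
  open import Data.Integer.Divisibility.Signed using (_∣_; divides; ∣⇒∣ᵤ)
  import Data.Nat.Divisibility as ℕᵈ
  import Data.Nat.Properties as ℕₚ
  open import Data.Integer.Tactic.RingSolver using (solve-∀)
  open import Data.List using (List; []; _∷_; _++_; map; reverse; length; [_])
  open import Data.List.Properties using (unfold-reverse; map-∘; map-cong)
  open import Data.List.Relation.Unary.All as All using (All; []; _∷_)
  open import Data.List.Relation.Unary.AllPairs as AllPairs using (AllPairs; []; _∷_)
  import Data.List.Relation.Unary.AllPairs.Properties as AllPairsₚ
  open import Data.List.Relation.Unary.Unique.Propositional using (Unique)
  open import Data.List.Relation.Binary.Permutation.Propositional as Perm
    using (_↭_; ↭⇒↭ₛ; ↭-sym; ↭-trans; ↭-reflexive; prep)
  open import Data.List.Relation.Binary.Permutation.Propositional.Properties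
    using (++-comm; drop-∷; ↭-reverse; ↭-length; ∷↭∷ʳ)
  import Data.List.Relation.Binary.Permutation.Setoid.Properties as Permₛ
  open import Data.Product using (_×_; _,_)
  open import Data.Sum using (inj₁; inj₂; _⊎_)
  open import Relation.Binary.PropositionalEquality hiding ([_])
  open import Relation.Nullary using (¬_)
  open import Function using (_∘_)

  scan : ℤ → List ℤ → List ℤ
  scan s []       = []
  scan s (x ∷ xs) = (s + x) ∷ scan (s + x) xs

  -- The helper of partialSums is not nameable from here, so only partialSums itself can appear
  -- in the induction.
  partialSums-∷ : ∀ s xs → partialSums (s ∷ xs) ≡ s ∷ scan s xs
  partialSums-∷ s [] = cong [_] (+-identityˡ s)
  partialSums-∷ s (x ∷ xs) = trans merge (cong₂ _∷_ (+-identityˡ s) (partialSums-∷ (s + x) xs))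
    where
    merge : partialSums (s ∷ x ∷ xs) ≡ (0ℤ + s) ∷ partialSums ((s + x) ∷ xs)
    merge rewrite +-assoc 0ℤ s x = refl

  partialSums≡scan : ∀ xs → partialSums xs ≡ scan 0ℤ xs
  partialSums≡scan []       = refl
  partialSums≡scan (x ∷ xs) =
    trans (partialSums-∷ x xs) (cong (λ s → s ∷ scan s xs) (sym (+-identityˡ x)))

  scan-++ : ∀ s xs ys → scan s (xs ++ ys) ≡ scan s xs ++ scan (s + sumℤ xs) ys
  scan-++ s []       ys = cong (λ z → scan z ys) (sym (+-identityʳ s))
  scan-++ s (x ∷ xs) ys = cong ((s + x) ∷_) (trans (scan-++ (s + x) xs ys)
    (cong (λ z → scan (s + x) xs ++ scan z ys) (+-assoc s x (sumℤ xs))))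

  scan-+ : ∀ c s xs → scan (c + s) xs ≡ map (_+_ c) (scan s xs)
  scan-+ c s []       = refl
  scan-+ c s (x ∷ xs) rewrite +-assoc c s x = cong ((c + (s + x)) ∷_) (scan-+ c (s + x) xs)

  sumℤ-++ : ∀ xs ys → sumℤ (xs ++ ys) ≡ sumℤ xs + sumℤ ys
  sumℤ-++ []       ys = sym (+-identityˡ _)
  sumℤ-++ (x ∷ xs) ys = trans (cong (_+_ x) (sumℤ-++ xs ys)) (sym (+-assoc x (sumℤ xs) (sumℤ ys)))

  sumℤ-reverse : ∀ xs → sumℤ (reverse xs) ≡ sumℤ xs
  sumℤ-reverse []       = refl
  sumℤ-reverse (x ∷ xs) = begin
    sumℤ (reverse (x ∷ xs))       ≡⟨ cong sumℤ (unfold-reverse x xs) ⟩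
    sumℤ (reverse xs ++ [ x ])    ≡⟨ sumℤ-++ (reverse xs) [ x ] ⟩
    sumℤ (reverse xs) + (x + 0ℤ)  ≡⟨ cong₂ _+_ (sumℤ-reverse xs) (+-identityʳ x) ⟩
    sumℤ xs + x                   ≡⟨ +-comm (sumℤ xs) x ⟩
    x + sumℤ xs                   ∎
    where open ≡-Reasoning

  scan-∷ : ∀ x xs → scan 0ℤ (x ∷ xs) ≡ map (_+_ x) (0ℤ ∷ scan 0ℤ xs)
  scan-∷ x xs = begin
    0ℤ + x ∷ scan (0ℤ + x) xs          ≡⟨ cong (λ z → z ∷ scan z xs) (+-comm 0ℤ x) ⟩
    x + 0ℤ ∷ scan (x + 0ℤ) xs          ≡⟨ cong (x + 0ℤ ∷_) (scan-+ x 0ℤ xs) ⟩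
    map (_+_ x) (0ℤ ∷ scan 0ℤ xs)      ∎
    where open ≡-Reasoning

  -- The sum of a final segment is the total minus the sum of the rest, so reversal reflects the
  -- partial sums. The empty sum is listed on both sides because the reflection exchanges it with
  -- the full sum.
  scan-reverse : ∀ s xs →
    s ∷ scan s (reverse xs) ↭ map (λ z → s + sumℤ xs - z) (0ℤ ∷ scan 0ℤ xs)
  scan-reverse s [] = ↭-reflexive (cong [_] (eq s))
    where
    eq : ∀ s → s ≡ s + 0ℤ - 0ℤ
    eq = solve-∀
  scan-reverse s (x ∷ xs) = begin
    s ∷ scan s (reverse (x ∷ xs))
      ≡⟨ cong (λ l → s ∷ scan s l) (unfold-reverse x xs) ⟩
    s ∷ scan s (reverse xs ++ [ x ])
      ≡⟨ cong (s ∷_) (scan-++ s (reverse xs) [ x ]) ⟩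
    (s ∷ scan s (reverse xs)) ++ [ s + sumℤ (reverse xs) + x ]
      ↭⟨ ∷↭∷ʳ _ (s ∷ scan s (reverse xs)) ⟨
    s + sumℤ (reverse xs) + x ∷ s ∷ scan s (reverse xs)
      ↭⟨ prep _ (scan-reverse s xs) ⟩
    s + sumℤ (reverse xs) + x ∷ map (λ z → s + sumℤ xs - z) (0ℤ ∷ scan 0ℤ xs)
      ≡⟨ cong₂ _∷_ (trans (cong (λ z → s + z + x) (sumℤ-reverse xs)) (eq₁ s (sumℤ xs) x)) shift ⟩
    map (λ z → s + sumℤ (x ∷ xs) - z) (0ℤ ∷ scan 0ℤ (x ∷ xs)) ∎
    where
    open Perm.PermutationReasoning
    eq₁ : ∀ s Σ x → s + Σ + x ≡ s + (x + Σ) - 0ℤ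
    eq₁ = solve-∀
    eq₂ : ∀ s Σ x z → s + Σ - z ≡ s + (x + Σ) - (x + z)
    eq₂ = solve-∀
    shift : map (λ z → s + sumℤ xs - z) (0ℤ ∷ scan 0ℤ xs)
          ≡ map (λ z → s + sumℤ (x ∷ xs) - z) (scan 0ℤ (x ∷ xs))
    shift = trans (map-cong (eq₂ s (sumℤ xs) x) (0ℤ ∷ scan 0ℤ xs))
      (trans (map-∘ (0ℤ ∷ scan 0ℤ xs)) (cong (map _) (sym (scan-∷ x xs))))

  -- Non-divisibility of the difference, not inequality of remainders: translation and negation then
  -- need only a ring identity between differences.
  _≢_[mod_] : ℤ → ℤ → ℕ → Set
  a ≢ b [mod m ] = ¬ (+ m ∣ a - b)

  Incongruent : ℕ → List ℤ → Set
  Incongruent m = AllPairs (λ a b → a ≢ b [mod m ])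

  ≢mod-sym : ∀ {m a b} → a ≢ b [mod m ] → b ≢ a [mod m ]
  ≢mod-sym {m} {a} {b} ≢ (divides q eq) = ≢ (divides (- q) (begin
    a - b      ≡⟨ flip a b ⟩
    - (b - a)  ≡⟨ cong -_ eq ⟩
    - (q * + m) ≡⟨ neg-distribˡ-* q (+ m) ⟩
    - q * + m ∎))
    where
    open ≡-Reasoning
    flip : ∀ a b → a - b ≡ - (b - a)
    flip = solve-∀

  incongruent-↭ : ∀ {m xs ys} → xs ↭ ys → Incongruent m xs → Incongruent m ys
  incongruent-↭ {m} xs↭ys = Permₛ.AllPairs-resp-↭ (setoid ℤ)
    (λ {a} {b} → ≢mod-sym {m} {a} {b}) (resp₂ (λ a b → a ≢ b [mod m ])) (↭⇒↭ₛ xs↭ys)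

  incongruent-map : ∀ {m} (f : ℤ → ℤ) → (∀ {a b} → a ≢ b [mod m ] → f a ≢ f b [mod m ]) →
    ∀ {xs} → Incongruent m xs → Incongruent m (map f xs)
  incongruent-map f resp = AllPairsₚ.map⁺ ∘ AllPairs.map resp

  -- All that is asked of one line, in a form invariant under rotation and reversal.
  ZeroSumSimple : ℕ → ℕ → List ℤ → Set
  ZeroSumSimple m k xs = length xs ≡ k × sumℤ xs ≡ 0ℤ × Incongruent m (scan 0ℤ xs)

  -- As the total is zero, starting the line at `ys` adds the constant `sumℤ ys` to every partial
  -- sum and otherwise only permutes them.
  zeroSumSimple-rotate : ∀ {m k} xs ys → ZeroSumSimple m k (xs ++ ys) → ZeroSumSimple m k (ys ++ xs)
  zeroSumSimple-rotate {m} xs ys (len , Σ≡0 , inc) =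
    trans (↭-length (++-comm ys xs)) len ,
    trans (sumℤ-++ ys xs) Σ≡0′ ,
    incongruent-↭ rotated
      (incongruent-map (_+_ (sumℤ ys)) (λ {a} {b} → transport (sumℤ ys) a b) inc)
    where
    Σ≡0′ : sumℤ ys + sumℤ xs ≡ 0ℤ
    Σ≡0′ = trans (+-comm (sumℤ ys) (sumℤ xs)) (trans (sym (sumℤ-++ xs ys)) Σ≡0)
    transport : ∀ c a b → a ≢ b [mod m ] → (c + a) ≢ (c + b) [mod m ]
    transport c a b = subst (λ z → ¬ (+ m ∣ z)) (eq c a b)
      where
      eq : ∀ c a b → a - b ≡ (c + a) - (c + b)
      eq = solve-∀
    rotated : map (_+_ (sumℤ ys)) (scan 0ℤ (xs ++ ys)) ↭ scan 0ℤ (ys ++ xs)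
    rotated = begin
      map (_+_ (sumℤ ys)) (scan 0ℤ (xs ++ ys))
        ≡⟨ scan-+ (sumℤ ys) 0ℤ (xs ++ ys) ⟨
      scan (sumℤ ys + 0ℤ) (xs ++ ys)
        ≡⟨ cong (λ z → scan z (xs ++ ys)) (+-comm (sumℤ ys) 0ℤ) ⟩
      scan (0ℤ + sumℤ ys) (xs ++ ys)
        ≡⟨ scan-++ (0ℤ + sumℤ ys) xs ys ⟩
      scan (0ℤ + sumℤ ys) xs ++ scan (0ℤ + sumℤ ys + sumℤ xs) ys
        ≡⟨ cong (λ z → scan (0ℤ + sumℤ ys) xs ++ scan z ys)
             (trans (+-assoc 0ℤ (sumℤ ys) (sumℤ xs)) (cong (_+_ 0ℤ) Σ≡0′)) ⟩
      scan (0ℤ + sumℤ ys) xs ++ scan 0ℤ ys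
        ↭⟨ ++-comm (scan (0ℤ + sumℤ ys) xs) (scan 0ℤ ys) ⟩
      scan 0ℤ ys ++ scan (0ℤ + sumℤ ys) xs
        ≡⟨ scan-++ 0ℤ ys xs ⟨
      scan 0ℤ (ys ++ xs) ∎
      where open Perm.PermutationReasoning

  zeroSumSimple-reverse : ∀ {m k} xs → ZeroSumSimple m k xs → ZeroSumSimple m k (reverse xs)
  zeroSumSimple-reverse {m} xs (len , Σ≡0 , inc) =
    trans (↭-length (↭-reverse xs)) len ,
    trans (sumℤ-reverse xs) Σ≡0 ,
    incongruent-↭ (↭-sym negated) (incongruent-map -_ (λ {a} {b} → transport a b) inc)
    where
    transport : ∀ a b → a ≢ b [mod m ] → (- a) ≢ (- b) [mod m ]
    transport a b = subst (λ z → ¬ (+ m ∣ z)) (eq a b) ∘ ≢mod-sym {m} {a} {b}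
      where
      eq : ∀ a b → b - a ≡ (- a) - (- b)
      eq = solve-∀
    negated : scan 0ℤ (reverse xs) ↭ map -_ (scan 0ℤ xs)
    -- With total zero the reflection is negation, which fixes the empty sum; this common head is
    -- dropped.
    negated = drop-∷ (↭-trans (scan-reverse 0ℤ xs) (↭-reflexive
      (map-cong (λ z → trans (cong (λ Σ → 0ℤ + Σ - z) Σ≡0) (+-identityˡ (- z))) (0ℤ ∷ scan 0ℤ xs))))

  %ℕ≡⇒∣- : ∀ m .{{_ : NonZero m}} a b → a %ℕ m ≡ b %ℕ m → + m ∣ a - b
  %ℕ≡⇒∣- m a b eq = divides (a /ℕ m - b /ℕ m) (begin
    a - b
      ≡⟨ cong₂ _-_ (a≡a%ℕn+[a/ℕn]*n a m) (a≡a%ℕn+[a/ℕn]*n b m) ⟩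
    (+ (a %ℕ m) + a /ℕ m * + m) - (+ (b %ℕ m) + b /ℕ m * + m)
      ≡⟨ cong (λ r → (+ r + a /ℕ m * + m) - (+ (b %ℕ m) + b /ℕ m * + m)) eq ⟩
    (+ (b %ℕ m) + a /ℕ m * + m) - (+ (b %ℕ m) + b /ℕ m * + m)
      ≡⟨ cancel (+ (b %ℕ m)) (a /ℕ m) (b /ℕ m) (+ m) ⟩
    (a /ℕ m - b /ℕ m) * + m ∎)
    where
    open ≡-Reasoning
    cancel : ∀ r p q m → (r + p * m) - (r + q * m) ≡ (p - q) * m
    cancel = solve-∀

  incongruent⇒simpleMod : ∀ m .{{_ : NonZero m}} xs → Incongruent m (scan 0ℤ xs) → SimpleMod m xs
  incongruent⇒simpleMod m xs inc = subst (λ l → Unique (map (_%ℕ m) l)) (sym (partialSums≡scan xs))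
    (AllPairsₚ.map⁺ (AllPairs.map (λ {a} {b} a≢b eq → a≢b (%ℕ≡⇒∣- m a b eq)) inc))

  -- Two distinct integers in a half-open interval of length `m` differ by a nonzero amount of
  -- absolute value below `m`, which `m` cannot divide.
  window⇒≢mod : ∀ {m lo a b} → lo ≤ a → a < lo + + m → lo ≤ b → b < lo + + m →
    a ≢ b → a ≢ b [mod m ]
  window⇒≢mod {m} {lo} {a} {b} lo≤a a<hi lo≤b b<hi a≢b m∣a-b =
    ℕₚ.<⇒≱ (∣-∣<m (≤-total a b)) (ℕᵈ.∣⇒≤ {{difference≢0}} (∣⇒∣ᵤ m∣a-b))
    where
    difference≢0 : NonZero ∣ a - b ∣
    difference≢0 = ℕ.≢-nonZero (λ eq → a≢b (i-j≡0⇒i≡j a b (∣i∣≡0⇒i≡0 eq)))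
    lt : ∀ {a b} → lo ≤ a → b < lo + + m → b - a < + m
    lt {a} {b} lo≤a b<hi = begin-strict
      b - a          ≤⟨ +-monoʳ-≤ b (neg-mono-≤ lo≤a) ⟩
      b - lo         <⟨ +-monoˡ-< (- lo) b<hi ⟩
      lo + + m - lo  ≡⟨ cancel lo (+ m) ⟩
      + m ∎
      where
      open ≤-Reasoning
      cancel : ∀ lo m → lo + m - lo ≡ m
      cancel = solve-∀
    abs : ∀ {z} → 0ℤ ≤ z → z < + m → ∣ z ∣ ℕ.< m
    abs (+≤+ _) (+<+ z<m) = z<m
    ∣-∣<m : a ≤ b ⊎ b ≤ a → ∣ a - b ∣ ℕ.< m
    ∣-∣<m = λ where
      (inj₁ a≤b) → subst (ℕ._< m) (∣i-j∣≡∣j-i∣ b a) (abs (i≤j⇒0≤j-i a≤b) (lt lo≤a b<hi))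
      (inj₂ b≤a) → abs (i≤j⇒0≤j-i b≤a) (lt lo≤b a<hi)

  unique⇒incongruent : ∀ {m} lo {xs} → All (λ a → lo ≤ a × a < lo + + m) xs → Unique xs →
    Incongruent m xs
  unique⇒incongruent lo []                 []         = []
  unique⇒incongruent lo ((l , h) ∷ bounds) (≢s ∷ uniq) =
    All.zipWith (λ ((l′ , h′) , ≢) → window⇒≢mod l h l′ h′ ≢) (bounds , ≢s) ∷
    unique⇒incongruent lo bounds uniq

-- Zero-sum lines made of three entries and two groups of pairs.

module PairedDiagonals where

  open PartialSums
  open import Data.Nat as ℕ using (ℕ; zero; suc; NonZero)
  open import Data.Integer hiding (NonZero; suc)
  open import Data.Integer.Properties
  import Data.Nat.Properties as ℕₚ
  open import Data.Integer.Tactic.RingSolver using (solve-∀)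
  open import Data.Nat.Tactic.RingSolver using () renaming (solve-∀ to ℕ-solve-∀)
  open import Data.List using (List; []; _∷_; _++_; length; applyUpTo)
  open import Data.List.Properties using (length-++)
  open import Data.List.Relation.Unary.All as All using (All; []; _∷_)
  import Data.List.Relation.Unary.All.Properties as Allₚ
  open import Data.List.Relation.Unary.AllPairs using (AllPairs; []; _∷_)
  import Data.List.Relation.Unary.AllPairs.Properties as AllPairsₚ
  open import Data.List.Relation.Unary.Unique.Propositional using (Unique)
  open import Data.List.Relation.Binary.Permutation.Propositional
    using (_↭_; prep; ↭-sym; ↭-trans; ↭-refl; ↭-reflexive)
  open import Data.List.Relation.Binary.Permutation.Propositional.Properties
    using (++-comm; ++⁺; shift)
  open import Data.Product using (_×_; _,_)
  open import Data.Sum using (inj₁; inj₂)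
  open import Relation.Binary.PropositionalEquality hiding ([_])
  open import Function using (_∘_)

  infixl 6 _⊕_
  infixl 7 _⊛_

  _⊕_ : ∀ {a b} → 0ℤ ≤ a → 0ℤ ≤ b → 0ℤ ≤ a + b
  _⊕_ = +-mono-≤

  _⊛_ : ∀ {a b} → 0ℤ ≤ a → 0ℤ ≤ b → 0ℤ ≤ a * b
  _⊛_ {+ m} {+ k} _ _ = subst (0ℤ ≤_) (pos-* m k) (+≤+ ℕ.z≤n)

  0≤+ : ∀ {k} → 0ℤ ≤ + k
  0≤+ = +≤+ ℕ.z≤n

  diff : ∀ {a b} → a ≤ b → 0ℤ ≤ b - a
  diff = i≤j⇒0≤j-i

  -- Linear inequalities are proved by exhibiting b - a as a nonnegative combination of hypotheses.
  ≤-by : ∀ {a b e} → 0ℤ ≤ e → e ≡ b - a → a ≤ b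
  ≤-by 0≤e refl = 0≤i-j⇒j≤i 0≤e

  <-by : ∀ {a b e} → 0ℤ ≤ e → e ≡ b - (1ℤ + a) → a < b
  <-by 0≤e eq = suc[i]≤j⇒i<j (≤-by 0≤e eq)

  interleave : ∀ {A : Set} → (ℕ → A) → (ℕ → A) → ℕ → List A
  interleave f g zero    = []
  interleave f g (suc p) = f 0 ∷ g 0 ∷ interleave (f ∘ suc) (g ∘ suc) p

  interleave-cong : ∀ {A : Set} {f f′ g g′ : ℕ → A} p →
    (∀ t → t ℕ.< p → f t ≡ f′ t) → (∀ t → t ℕ.< p → g t ≡ g′ t) →
    interleave f g p ≡ interleave f′ g′ p
  interleave-cong zero    f≗ g≗ = refl
  interleave-cong (suc p) f≗ g≗ = cong₂ _∷_ (f≗ 0 ℕ.z<s) (cong₂ _∷_ (g≗ 0 ℕ.z<s)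
    (interleave-cong p (λ t → f≗ (suc t) ∘ ℕ.s<s) (λ t → g≗ (suc t) ∘ ℕ.s<s)))

  interleave-↭ : ∀ {A : Set} (f g : ℕ → A) p → interleave f g p ↭ applyUpTo f p ++ applyUpTo g p
  interleave-↭ f g zero    = ↭-refl
  interleave-↭ f g (suc p) = prep (f 0) (↭-trans (prep (g 0) (interleave-↭ (f ∘ suc) (g ∘ suc) p))
    (↭-sym (shift (g 0) (applyUpTo (f ∘ suc) p) (applyUpTo (g ∘ suc) p))))

  length-interleave : ∀ {A : Set} (f g : ℕ → A) p → length (interleave f g p) ≡ p ℕ.* 2
  length-interleave f g zero    = refl
  length-interleave f g (suc p) = cong (suc ∘ suc) (length-interleave (f ∘ suc) (g ∘ suc) p)

  -- Every pair adds `- D` whatever `x t` is. The pairs `- y t`, `y t + D` of the other group are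
  -- `pairs (- D) (-_ ∘ y)`, so both groups share the lemmas below.
  pairs : ℤ → (ℕ → ℤ) → ℕ → List ℤ
  pairs D x = interleave x (λ t → - (x t + D))

  sumℤ-pairs : ∀ D x p → sumℤ (pairs D x p) ≡ - (+ p * D)
  sumℤ-pairs D x zero    = refl
  sumℤ-pairs D x (suc p) =
    trans (cong (λ z → x 0 + (- (x 0 + D) + z)) (sumℤ-pairs D (x ∘ suc) p)) (eq (x 0) D (+ p))
    where
    eq : ∀ x D P → x + (- (x + D) + - (P * D)) ≡ - ((1ℤ + P) * D)
    eq = solve-∀

  -- The sums after whole pairs form an arithmetic progression of step `- D`; the sum inside pair
  -- `t` exceeds the one before that pair by `x t`.
  scan-pairs : ∀ s D x p →
    scan s (pairs D x p) ≡ interleave (λ t → s - + t * D + x t) (λ t → s - + suc t * D) p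
  scan-pairs s D x zero    = refl
  scan-pairs s D x (suc p) = cong₂ _∷_ (eq₀ s D (x 0)) (cong₂ _∷_ (eq₁ s D (x 0)) (begin
    scan (s + x 0 + - (x 0 + D)) (pairs D (x ∘ suc) p)
      ≡⟨ cong (λ z → scan z (pairs D (x ∘ suc) p)) (eq₁ s D (x 0)) ⟩
    scan (s - 1ℤ * D) (pairs D (x ∘ suc) p)
      ≡⟨ scan-pairs (s - 1ℤ * D) D (x ∘ suc) p ⟩
    _ ≡⟨ interleave-cong p (λ t _ → eq₂ s D (+ t) (x (suc t))) (λ t _ → eq₃ s D (+ suc t)) ⟩
    interleave (λ t → s - + suc t * D + x (suc t)) (λ t → s - + suc (suc t) * D) p ∎))
    where
    open ≡-Reasoning
    eq₀ : ∀ s D x → s + x ≡ s - 0ℤ * D + x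
    eq₀ = solve-∀
    eq₁ : ∀ s D x → s + x + - (x + D) ≡ s - 1ℤ * D
    eq₁ = solve-∀
    eq₂ : ∀ s D T x → s - 1ℤ * D - T * D + x ≡ s - (1ℤ + T) * D + x
    eq₂ = solve-∀
    eq₃ : ∀ s D T → s - 1ℤ * D - T * D ≡ s - (1ℤ + T) * D
    eq₃ = solve-∀

  increasing⇒< : ∀ {f : ℕ → ℤ} → (∀ t → f t < f (suc t)) → ∀ {s t} → s ℕ.< t → f s < f t
  increasing⇒< {f} step {s} {suc t} (ℕ.s≤s s≤t) with ℕₚ.m≤n⇒m<n∨m≡n s≤t
  ... | inj₁ s<t  = <-trans (increasing⇒< step s<t) (step t)
  ... | inj₂ refl = step s

  increasing⇒≤ : ∀ {f : ℕ → ℤ} → (∀ t → f t < f (suc t)) → ∀ t → f 0 ≤ f t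
  increasing⇒≤ step zero    = ≤-refl
  increasing⇒≤ step (suc t) = <⇒≤ (increasing⇒< step ℕ.z<s)

  increasing⇒unique : ∀ {f : ℕ → ℤ} → (∀ t → f t < f (suc t)) → ∀ n → Unique (applyUpTo f n)
  increasing⇒unique {f} step n =
    AllPairsₚ.applyUpTo⁺₁ f n (λ s<t _ → <⇒≢ (increasing⇒< step s<t))

  decreasing⇒unique : ∀ {f : ℕ → ℤ} → (∀ t → f (suc t) < f t) → ∀ n → Unique (applyUpTo f n)
  decreasing⇒unique {f} step n = AllPairsₚ.applyUpTo⁺₁ f n
    (λ s<t _ eq → <⇒≢ (increasing⇒< {f = -_ ∘ f} (neg-mono-< ∘ step) s<t) (cong -_ eq))

  separated : ∀ {c xs ys} → All (_< c) xs → All (c ≤_) ys → All (λ x → All (x ≢_) ys) xs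
  separated xs< ≤ys = All.map (λ x<c → All.map (λ c≤y → <⇒≢ (<-≤-trans x<c c≤y)) ≤ys) xs<

  0≢∣b∣<D⇒b≢zD : ∀ {b D} → b ≢ 0ℤ → b < D → - b < D → 0ℤ ≤ D → ∀ z → b ≢ z * D
  0≢∣b∣<D⇒b≢zD {b} {D} b≢0 b<D -b<D 0≤D (+ zero)  eq = b≢0 eq
  0≢∣b∣<D⇒b≢zD {b} {D} b≢0 b<D -b<D 0≤D (+ suc z) refl =
    <⇒≱ b<D (≤-by (0≤+ {z} ⊛ 0≤D) (lem (+ z) D))
    where
    lem : ∀ z D → z * D ≡ (1ℤ + z) * D - D
    lem = solve-∀
  0≢∣b∣<D⇒b≢zD {b} {D} b≢0 b<D -b<D 0≤D -[1+ z ] refl =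
    <⇒≱ -b<D (≤-by (0≤+ {z} ⊛ 0≤D) (lem (+ z) D))
    where
    lem : ∀ z D → z * D ≡ - (- (1ℤ + z) * D) - D
    lem = solve-∀

  -- One row or column read by diagonals: `a` and `c`, then `p` pairs, then `b`, then `p` more
  -- pairs. Here `n` is the order of the array, and `x≤` and `y≤` give the upper ends (4t + 4)n and
  -- (4t + 5)n of the blocks of `n` consecutive numbers that supply `x t` and `y t`.
  module Line
    (p : ℕ) (0<p : 0 ℕ.< p) (n D a b c : ℤ) (x y : ℕ → ℤ)
    (0≤n : 0ℤ ≤ n) (n<D : 1ℤ + n ≤ D) (D<3n : 1ℤ + D ≤ + 3 * n)
    (n<a : 1ℤ + n ≤ a) (a+b≤3n : a + b ≤ + 3 * n) (-n≤b : - n ≤ b) (b≤n : b ≤ n) (b≢0 : b ≢ 0ℤ)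
    (a+c≡-b : a + c ≡ - b)
    (x-step : ∀ t → 1ℤ + (x t + D) ≤ x (ℕ.suc t)) (3n<x₀ : 1ℤ + + 3 * n ≤ x 0)
    (x≤ : ∀ t → x t ≤ (1ℤ + + t) * (+ 4 * n))
    (y-step : ∀ t → 1ℤ + (y t + D) ≤ y (ℕ.suc t)) (n<y₀ : 1ℤ + n ≤ y 0)
    (y≤ : ∀ t → y t ≤ (+ 4 * + t + + 5) * n)
    where

    line : List ℤ
    line = a ∷ c ∷ pairs D x p ++ b ∷ pairs (- D) (-_ ∘ y) p

    length-line : length line ≡ 4 ℕ.* p ℕ.+ 3
    length-line = begin
      suc (suc (length (pairs D x p ++ b ∷ pairs (- D) (-_ ∘ y) p)))
        ≡⟨ cong (suc ∘ suc) (length-++ (pairs D x p)) ⟩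
      suc (suc (length (pairs D x p) ℕ.+ suc (length (pairs (- D) (-_ ∘ y) p))))
        ≡⟨ cong₂ (λ l l′ → suc (suc (l ℕ.+ suc l′)))
             (length-interleave _ _ p) (length-interleave _ _ p) ⟩
      suc (suc (p ℕ.* 2 ℕ.+ suc (p ℕ.* 2)))
        ≡⟨ count p ⟩
      4 ℕ.* p ℕ.+ 3 ∎
      where
      open ≡-Reasoning
      count : ∀ p → suc (suc (p ℕ.* 2 ℕ.+ suc (p ℕ.* 2))) ≡ 4 ℕ.* p ℕ.+ 3
      count = ℕ-solve-∀

    sumℤ-line : sumℤ line ≡ 0ℤ
    sumℤ-line = begin
      a + (c + sumℤ (pairs D x p ++ b ∷ pairs (- D) (-_ ∘ y) p))
        ≡⟨ cong (λ z → a + (c + z)) (sumℤ-++ (pairs D x p) _) ⟩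
      a + (c + (sumℤ (pairs D x p) + (b + sumℤ (pairs (- D) (-_ ∘ y) p))))
        ≡⟨ cong₂ (λ z z′ → a + (c + (z + (b + z′))))
             (sumℤ-pairs D x p) (sumℤ-pairs (- D) (-_ ∘ y) p) ⟩
      a + (c + (- (+ p * D) + (b + - (+ p * - D))))
        ≡⟨ regroup a b c (+ p) D ⟩
      a + c + b
        ≡⟨ cong (λ z → z + b) a+c≡-b ⟩
      - b + b
        ≡⟨ +-inverseˡ b ⟩
      0ℤ ∎
      where
      open ≡-Reasoning
      regroup : ∀ a b c P D → a + (c + (- (P * D) + (b + - (P * - D)))) ≡ a + c + b
      regroup = solve-∀

    -- `lo` bounds the smallest sum, `- D - y (p - 1)`, where `y (p - 1) ≤ (4p + 1)n` and `D < 3n`.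
    -- `c₁` is a lower bound for the sums after whole pairs, since `- b ≥ - n` and at most `p`
    -- copies of `D` are subtracted.
    P lo c₁ : ℤ
    P  = + p
    lo = - (+ 4 * (1ℤ + P) * n)
    c₁ = - n - P * D

    -- The partial sums lie in the order o₂ < c₁ ≤ e₁, e₂ < 1 + n ≤ h.
    o₁ e₁ o₂ e₂ h : ℕ → ℤ
    e₁ t = - b - + t * D
    o₁ t = - b - + t * D + x t
    e₂ t = - (P * D) - + t * - D
    o₂ t = - (P * D) - + t * - D + - y t
    h zero    = a
    h (suc t) = o₁ t

    0≤D : 0ℤ ≤ D
    0≤D = ≤-trans (0≤+ {1} ⊕ 0≤n) n<D

    -- Because `a + c = - b`, the second sum is `- b`, and the later entry `b` cancels it, leaving
    -- `- (P * D)`. From there the second group adds `D` per pair and returns to 0.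
    scan-line : scan 0ℤ line ≡
      (a ∷ e₁ 0 ∷ interleave o₁ (e₁ ∘ suc) p) ++ (e₂ 0 ∷ interleave o₂ (e₂ ∘ suc) p)
    scan-line = cong₂ _∷_ (+-identityˡ a) (cong₂ _∷_ (trans second (eq₀ b D)) (begin
      scan (0ℤ + a + c) (pairs D x p ++ b ∷ pairs (- D) (-_ ∘ y) p)
        ≡⟨ cong (λ s → scan s (pairs D x p ++ b ∷ pairs (- D) (-_ ∘ y) p)) second ⟩
      scan (- b) (pairs D x p ++ b ∷ pairs (- D) (-_ ∘ y) p)
        ≡⟨ scan-++ (- b) (pairs D x p) _ ⟩
      scan (- b) (pairs D x p) ++ scan (- b + sumℤ (pairs D x p)) (b ∷ pairs (- D) (-_ ∘ y) p)
        ≡⟨ cong₂ (λ l s → l ++ s ∷ scan s (pairs (- D) (-_ ∘ y) p))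
             (scan-pairs (- b) D x p)
             (trans (cong (λ s → - b + s + b) (sumℤ-pairs D x p)) (eq₁ b P D)) ⟩
      interleave o₁ (e₁ ∘ suc) p ++ e₂ 0 ∷ scan (e₂ 0) (pairs (- D) (-_ ∘ y) p)
        ≡⟨ cong (λ l → interleave o₁ (e₁ ∘ suc) p ++ e₂ 0 ∷ l)
             (trans (cong (λ s → scan s (pairs (- D) (-_ ∘ y) p)) (eq₂ P D))
               (scan-pairs (- (P * D)) (- D) (-_ ∘ y) p)) ⟩
      interleave o₁ (e₁ ∘ suc) p ++ e₂ 0 ∷ interleave o₂ (e₂ ∘ suc) p ∎))
      where
      open ≡-Reasoning
      second : 0ℤ + a + c ≡ - b
      second = trans (cong (λ z → z + c) (+-identityˡ a)) a+c≡-b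
      eq₀ : ∀ b D → - b ≡ - b - 0ℤ * D
      eq₀ = solve-∀
      eq₁ : ∀ b P D → - b + - (P * D) + b ≡ - (P * D) - 0ℤ * - D
      eq₁ = solve-∀
      eq₂ : ∀ P D → - (P * D) - 0ℤ * - D ≡ - (P * D)
      eq₂ = solve-∀

    -- Regroups the sums into four monotone families, listed so that distinctness across families
    -- follows from the separating values `c₁` and `1 + n`, apart from `e₂` against `e₁`.
    scan-line-↭ : scan 0ℤ line ↭
      (applyUpTo o₂ p ++ applyUpTo e₂ (suc p)) ++ (applyUpTo e₁ (suc p) ++ applyUpTo h (suc p))
    scan-line-↭ = ↭-trans (↭-reflexive scan-line)
      (↭-trans (++-comm (a ∷ e₁ 0 ∷ interleave o₁ (e₁ ∘ suc) p) _) (++⁺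
        (↭-trans (prep (e₂ 0) (interleave-↭ o₂ (e₂ ∘ suc) p))
          (↭-sym (shift (e₂ 0) (applyUpTo o₂ p) (applyUpTo (e₂ ∘ suc) p))))
        (↭-trans (prep a (prep (e₁ 0) (↭-trans (interleave-↭ o₁ (e₁ ∘ suc) p)
            (++-comm (applyUpTo o₁ p) (applyUpTo (e₁ ∘ suc) p)))))
          (↭-sym (shift a (applyUpTo e₁ (suc p)) (applyUpTo o₁ p))))))

    -- The first entry lies below the sums inside pairs since `a + b ≤ 3n < x 0`; afterwards `x`
    -- grows by more than the `D` lost per pair.
    h-increasing : ∀ t → h t < h (suc t)
    h-increasing zero    = <-by (diff 3n<x₀ ⊕ diff a+b≤3n) (eq n a b D (x 0))
      where
      eq : ∀ n a b D x →
        x - (1ℤ + + 3 * n) + (+ 3 * n - (a + b)) ≡ - b - 0ℤ * D + x - (1ℤ + a)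
      eq = solve-∀
    h-increasing (suc t) = <-by (diff (x-step t)) (eq b D (+ t) (x t) (x (suc t)))
      where
      eq : ∀ b D T x x′ →
        x′ - (1ℤ + (x + D)) ≡ - b - (1ℤ + T) * D + x′ - (1ℤ + (- b - T * D + x))
      eq = solve-∀

    e₁-decreasing : ∀ t → e₁ (suc t) < e₁ t
    e₁-decreasing t = <-by (diff n<D ⊕ 0≤n) (eq n b D (+ t))
      where
      eq : ∀ n b D T → D - (1ℤ + n) + n ≡ - b - T * D - (1ℤ + (- b - (1ℤ + T) * D))
      eq = solve-∀

    e₂-increasing : ∀ t → e₂ t < e₂ (suc t)
    e₂-increasing t = <-by (diff n<D ⊕ 0≤n) (eq n P D (+ t))
      where
      eq : ∀ n P D T → D - (1ℤ + n) + n
        ≡ - (P * D) - (1ℤ + T) * - D - (1ℤ + (- (P * D) - T * - D))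
      eq = solve-∀

    o₂-decreasing : ∀ t → o₂ (suc t) < o₂ t
    o₂-decreasing t = <-by (diff (y-step t)) (eq P D (+ t) (y t) (y (suc t)))
      where
      eq : ∀ P D T y y′ → y′ - (1ℤ + (y + D))
        ≡ - (P * D) - T * - D + - y - (1ℤ + (- (P * D) - (1ℤ + T) * - D + - y′))
      eq = solve-∀

    e₁-lower : ∀ {t} → t ℕ.≤ p → c₁ ≤ e₁ t
    e₁-lower {t} t≤p = ≤-by (diff b≤n ⊕ diff (+≤+ t≤p) ⊛ 0≤D) (eq n b P (+ t) D)
      where
      eq : ∀ n b P T D → n - b + (P - T) * D ≡ - b - T * D - (- n - P * D)
      eq = solve-∀

    e₁-upper : ∀ t → e₁ t < 1ℤ + n
    e₁-upper t = <-by (diff -n≤b ⊕ 0≤+ {t} ⊛ 0≤D) (eq n b (+ t) D)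
      where
      eq : ∀ n b T D → b - - n + T * D ≡ 1ℤ + n - (1ℤ + (- b - T * D))
      eq = solve-∀

    e₂-lower : ∀ t → c₁ ≤ e₂ t
    e₂-lower t = ≤-by (0≤n ⊕ 0≤+ {t} ⊛ 0≤D) (eq n P (+ t) D)
      where
      eq : ∀ n P T D → n + T * D ≡ - (P * D) - T * - D - (- n - P * D)
      eq = solve-∀

    e₂-upper : ∀ {t} → t ℕ.≤ p → e₂ t < 1ℤ + n
    e₂-upper {t} t≤p = <-by (0≤n ⊕ diff (+≤+ t≤p) ⊛ 0≤D) (eq n P (+ t) D)
      where
      eq : ∀ n P T D → n + (P - T) * D ≡ 1ℤ + n - (1ℤ + (- (P * D) - T * - D))
      eq = solve-∀

    o₂-upper : ∀ t → o₂ t < c₁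
    o₂-upper zero    = <-by (diff n<y₀) (eq n P D (y 0))
      where
      eq : ∀ n P D y → y - (1ℤ + n) ≡ - n - P * D - (1ℤ + (- (P * D) - 0ℤ * - D + - y))
      eq = solve-∀
    o₂-upper (suc t) = <-trans (o₂-decreasing t) (o₂-upper t)

    o₂-lower : ∀ {t} → t ℕ.< p → lo ≤ o₂ t
    o₂-lower {t} t<p =
      -- The difference `o₂ t - lo` splits into `(4t + 5)n - y t`, `P - 1 - t` copies of `4n - D`,
      -- and one `3n - D`.
      ≤-by (diff (y≤ t) ⊕ diff (+≤+ t<p) ⊛ (0≤n ⊕ diff D<3n ⊕ 0≤+ {1}) ⊕ (diff D<3n ⊕ 0≤+ {1}))
        (eq n D P (+ t) (y t))
      where
      eq : ∀ n D P T y →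
        (+ 4 * T + + 5) * n - y + (P - (1ℤ + T)) * (n + (+ 3 * n - (1ℤ + D)) + 1ℤ)
          + (+ 3 * n - (1ℤ + D) + 1ℤ)
        ≡ - (P * D) - T * - D + - y - - (+ 4 * (1ℤ + P) * n)
      eq = solve-∀

    lo≤c₁ : lo ≤ c₁
    lo≤c₁ = ≤-by (0≤+ {3} ⊛ 0≤n ⊕ 0≤+ {p} ⊛ (0≤n ⊕ diff D<3n ⊕ 0≤+ {1})) (eq n D P)
      where
      eq : ∀ n D P → + 3 * n + P * (n + (+ 3 * n - (1ℤ + D)) + 1ℤ)
        ≡ - n - P * D - - (+ 4 * (1ℤ + P) * n)
      eq = solve-∀

    c₁≤1+n : c₁ ≤ 1ℤ + n
    c₁≤1+n = ≤-trans (e₂-lower 0) (<⇒≤ (e₂-upper ℕ.z≤n))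

    n<h : ∀ t → 1ℤ + n ≤ h t
    n<h t = ≤-trans n<a (increasing⇒≤ h-increasing t)

    -- The window has the length of the modulus `2nk + 1` for `k = 4p + 3`, so `hi` equals
    -- `(4p + 2)n + 1`.
    hi : ℤ
    hi = lo + (1ℤ + + 2 * n * (+ 4 * P + + 3))

    1+n≤hi : 1ℤ + n ≤ hi
    1+n≤hi = ≤-by (0≤+ {4} ⊛ 0≤+ {p} ⊛ 0≤n ⊕ 0≤n) (eq n P)
      where
      eq : ∀ n P → + 4 * P * n + n
        ≡ - (+ 4 * (1ℤ + P) * n) + (1ℤ + + 2 * n * (+ 4 * P + + 3)) - (1ℤ + n)
      eq = solve-∀

    h-upper : ∀ {t} → t ℕ.< suc p → h t < hi
    -- `a ≤ 3n - b ≤ 4n`, which lies below `hi` because `p` is positive.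
    h-upper {zero}  _ =
      <-by (diff a+b≤3n ⊕ diff -n≤b ⊕ diff (+≤+ 0<p) ⊛ (0≤+ {4} ⊛ 0≤n) ⊕ 0≤+ {2} ⊛ 0≤n) (eq n a b P)
      where
      eq : ∀ n a b P → + 3 * n - (a + b) + (b - - n) + (P - 1ℤ) * (+ 4 * n) + + 2 * n
        ≡ - (+ 4 * (1ℤ + P) * n) + (1ℤ + + 2 * n * (+ 4 * P + + 3)) - (1ℤ + a)
      eq = solve-∀
    h-upper {suc t} (ℕ.s≤s t<p) =
      <-by (diff (x≤ t) ⊕ diff -n≤b ⊕ 0≤+ {t} ⊛ 0≤D ⊕ diff (+≤+ t<p) ⊛ (0≤+ {4} ⊛ 0≤n) ⊕ 0≤n)
        (eq n b D P (+ t) (x t))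
      where
      eq : ∀ n b D P T x →
        (1ℤ + T) * (+ 4 * n) - x + (b - - n) + T * D + (P - (1ℤ + T)) * (+ 4 * n) + n
        ≡ - (+ 4 * (1ℤ + P) * n) + (1ℤ + + 2 * n * (+ 4 * P + + 3)) - (1ℤ + (- b - T * D + x))
      eq = solve-∀

    -- These two families overlap in range, so order alone cannot separate them. Modulo `D`,
    -- however, the sums `e₂` are 0 and the sums `e₁` are `- b`, with `0 < |b| ≤ n < D`.
    e₂≢e₁ : ∀ s t → e₂ s ≢ e₁ t
    e₂≢e₁ s t eq = 0≢∣b∣<D⇒b≢zD b≢0 b<D -b<D 0≤D (P - + s - + t)
      (trans (solve₁ b D (+ t))
        (trans (cong (λ z → - z - + t * D) (sym eq)) (solve₂ P (+ s) (+ t) D)))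
      where
      b<D : b < D
      b<D = <-by (diff b≤n ⊕ diff n<D) (lem n b D)
        where
        lem : ∀ n b D → n - b + (D - (1ℤ + n)) ≡ D - (1ℤ + b)
        lem = solve-∀
      -b<D : - b < D
      -b<D = <-by (diff -n≤b ⊕ diff n<D) (lem n b D)
        where
        lem : ∀ n b D → b - - n + (D - (1ℤ + n)) ≡ D - (1ℤ + - b)
        lem = solve-∀
      solve₁ : ∀ b D T → b ≡ - (- b - T * D) - T * D
      solve₁ = solve-∀
      solve₂ : ∀ P S T D → - (- (P * D) - S * - D) - T * D ≡ (P - S - T) * D
      solve₂ = solve-∀

    bounds : All (λ s → lo ≤ s × s < hi)
      ((applyUpTo o₂ p ++ applyUpTo e₂ (suc p)) ++ (applyUpTo e₁ (suc p) ++ applyUpTo h (suc p)))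
    bounds = Allₚ.++⁺
      (Allₚ.++⁺
        (Allₚ.applyUpTo⁺₁ o₂ p (λ {t} t<p →
          o₂-lower t<p , <-≤-trans (o₂-upper t) (≤-trans c₁≤1+n 1+n≤hi)))
        (Allₚ.applyUpTo⁺₁ e₂ (suc p) (λ {t} t≤p →
          ≤-trans lo≤c₁ (e₂-lower t) , <-≤-trans (e₂-upper (ℕ.s≤s⁻¹ t≤p)) 1+n≤hi)))
      (Allₚ.++⁺
        (Allₚ.applyUpTo⁺₁ e₁ (suc p) (λ {t} t≤p →
          ≤-trans lo≤c₁ (e₁-lower (ℕ.s≤s⁻¹ t≤p)) , <-≤-trans (e₁-upper t) 1+n≤hi))
        (Allₚ.applyUpTo⁺₁ h (suc p) (λ {t} t≤p →
          ≤-trans lo≤c₁ (≤-trans c₁≤1+n (n<h t)) , h-upper t≤p)))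

    unique : Unique
      ((applyUpTo o₂ p ++ applyUpTo e₂ (suc p)) ++ (applyUpTo e₁ (suc p) ++ applyUpTo h (suc p)))
    unique = AllPairsₚ.++⁺
      (AllPairsₚ.++⁺ (decreasing⇒unique o₂-decreasing p) (increasing⇒unique e₂-increasing (suc p))
        (separated o₂<c₁ c₁≤e₂))
      (AllPairsₚ.++⁺
        (decreasing⇒unique e₁-decreasing (suc p)) (increasing⇒unique h-increasing (suc p))
        (separated e₁<1+n 1+n≤h))
      (Allₚ.++⁺
        (separated o₂<c₁ (Allₚ.++⁺ c₁≤e₁ (All.map (≤-trans c₁≤1+n) 1+n≤h)))
        (All.zipWith (λ (≢e₁ , ≢h) → Allₚ.++⁺ ≢e₁ ≢h)
          ( Allₚ.applyUpTo⁺₂ e₂ (suc p) (λ s → Allₚ.applyUpTo⁺₂ e₁ (suc p) (e₂≢e₁ s))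
          , separated e₂<1+n 1+n≤h)))
      where
      o₂<c₁ : All (_< c₁) (applyUpTo o₂ p)
      o₂<c₁ = Allₚ.applyUpTo⁺₂ o₂ p o₂-upper
      c₁≤e₂ : All (c₁ ≤_) (applyUpTo e₂ (suc p))
      c₁≤e₂ = Allₚ.applyUpTo⁺₂ e₂ (suc p) e₂-lower
      e₂<1+n : All (_< 1ℤ + n) (applyUpTo e₂ (suc p))
      e₂<1+n = Allₚ.applyUpTo⁺₁ e₂ (suc p) (e₂-upper ∘ ℕ.s≤s⁻¹)
      c₁≤e₁ : All (c₁ ≤_) (applyUpTo e₁ (suc p))
      c₁≤e₁ = Allₚ.applyUpTo⁺₁ e₁ (suc p) (e₁-lower ∘ ℕ.s≤s⁻¹)
      e₁<1+n : All (_< 1ℤ + n) (applyUpTo e₁ (suc p))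
      e₁<1+n = Allₚ.applyUpTo⁺₂ e₁ (suc p) e₁-upper
      1+n≤h : All (1ℤ + n ≤_) (applyUpTo h (suc p))
      1+n≤h = Allₚ.applyUpTo⁺₂ h (suc p) n<h

    zeroSumSimple-line : ∀ m → + m ≡ 1ℤ + + 2 * n * (+ 4 * P + + 3) →
      ZeroSumSimple m (4 ℕ.* p ℕ.+ 3) line
    zeroSumSimple-line m m≡ = length-line , sumℤ-line ,
      incongruent-↭ (↭-sym scan-line-↭) (unique⇒incongruent lo
        (All.map (λ (l , u) → l , subst (λ z → _ < lo + z) (sym m≡) u) bounds) unique)

-- Arrays described by their cyclic diagonals.

module CyclicArrays where

  open PartialSums
  open import Data.Nat
  open import Data.Nat.Properties
  open import Data.Nat.DivMod
  open import Data.Nat.Tactic.RingSolver using (solve-∀)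
  open import Data.Integer as ℤ using (ℤ)
  open import Data.Fin using (Fin; toℕ; fromℕ<)
  open import Data.Fin.Properties using (toℕ<n; toℕ-fromℕ<)
  open import Data.List
    using (List; []; _∷_; _++_; map; catMaybes; reverse; allFin; tabulate; applyUpTo)
  open import Data.List.Properties using (map-tabulate; catMaybes-++; reverse-++)
  open import Data.Maybe using (Maybe; just; nothing)
  open import Data.Product using (_×_; _,_; ∃-syntax)
  open import Data.Sum using (_⊎_; inj₁; inj₂)
  open import Relation.Binary.PropositionalEquality
  open import Function using (_∘_; id)

  justs : ∀ {A : Set} → (ℕ → Maybe A) → ℕ → List A
  justs f n = catMaybes (applyUpTo f n)

  applyUpTo-++ : ∀ {A : Set} (f : ℕ → A) a b →
    applyUpTo f (a + b) ≡ applyUpTo f a ++ applyUpTo (f ∘ (a +_)) b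
  applyUpTo-++ f zero    b = refl
  applyUpTo-++ f (suc a) b = cong (f 0 ∷_) (applyUpTo-++ (f ∘ suc) a b)

  applyUpTo-cong : ∀ {A : Set} {f g : ℕ → A} n → (∀ {i} → i < n → f i ≡ g i) →
    applyUpTo f n ≡ applyUpTo g n
  applyUpTo-cong zero    f≗g = refl
  applyUpTo-cong (suc n) f≗g = cong₂ _∷_ (f≗g z<s) (applyUpTo-cong n (f≗g ∘ s<s))

  tabulate-toℕ : ∀ {A : Set} (f : ℕ → A) n → tabulate {n = n} (f ∘ toℕ) ≡ applyUpTo f n
  tabulate-toℕ f zero    = refl
  tabulate-toℕ f (suc n) = cong (f 0 ∷_) (tabulate-toℕ (f ∘ suc) n)

  module _ {A : Set} where

    justs-++ : ∀ (f : ℕ → Maybe A) a b {n} → a + b ≡ n →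
      justs f n ≡ justs f a ++ justs (f ∘ (a +_)) b
    justs-++ f a b refl = trans (cong catMaybes (applyUpTo-++ f a b))
      (catMaybes-++ (applyUpTo f a) (applyUpTo (f ∘ (a +_)) b))

    justs-cong : ∀ {f g : ℕ → Maybe A} n → (∀ {i} → i < n → f i ≡ g i) → justs f n ≡ justs g n
    justs-cong n f≗g = cong catMaybes (applyUpTo-cong n f≗g)

    justs-nothing : ∀ {f : ℕ → Maybe A} n → (∀ {i} → i < n → f i ≡ nothing) → justs f n ≡ []
    justs-nothing {f} n f≡nothing = trans (justs-cong n f≡nothing) (none n)
      where
      none : ∀ n → justs {A} (λ _ → nothing) n ≡ []
      none zero    = refl
      none (suc n) = none n

    justs-reverse : ∀ (f : ℕ → Maybe A) n → justs (λ i → f (n ∸ suc i)) n ≡ reverse (justs f n)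
    justs-reverse f zero    = refl
    justs-reverse f (suc n) = begin
      justs (λ i → f (n ∸ i)) (suc n)
        ≡⟨ justs-++ (λ i → f (n ∸ i)) 1 n refl ⟩
      justs (λ _ → f n) 1 ++ justs (λ i → f (n ∸ suc i)) n
        ≡⟨ cong₂ _++_ (last (f n)) (justs-reverse f n) ⟩
      reverse (justs (λ _ → f n) 1) ++ reverse (justs f n)
        ≡⟨ reverse-++ (justs f n) (justs (λ _ → f n) 1) ⟨
      reverse (justs f n ++ justs (λ _ → f n) 1)
        ≡⟨ cong (λ x → reverse (justs f n ++ justs (λ _ → f x) 1)) (+-identityʳ n) ⟨
      reverse (justs f n ++ justs (f ∘ (n +_)) 1)
        ≡⟨ cong reverse (justs-++ f n 1 (+-comm n 1)) ⟨
      reverse (justs f (suc n)) ∎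
      where
      open ≡-Reasoning
      last : ∀ x → justs (λ _ → x) 1 ≡ reverse (justs {A} (λ _ → x) 1)
      last (just _) = refl
      last nothing  = refl

  split< : ∀ a y → y < a ⊎ ∃[ r ] y ≡ a + r
  split< a y with <-≤-connex y a
  ... | inj₁ y<a = inj₁ y<a
  ... | inj₂ a≤y = inj₂ (y ∸ a , sym (m+[n∸m]≡n a≤y))

  module Cyclic (N : ℕ) where

    n : ℕ
    n = suc N

    -- The added `n` keeps the subtraction from truncating for `i ≤ n`. Since sending `i` to `j - i`
    -- is an involution modulo `n`, `diagonal d j` is also the row in which diagonal `d` meets
    -- column `j`.
    diagonal : ℕ → ℕ → ℕ
    diagonal i j = (n + j ∸ i) % n

    diagonal-+ : ∀ i {e} → e < n → diagonal i (i + e) ≡ e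
    diagonal-+ i {e} e<n = begin
      (n + (i + e) ∸ i) % n    ≡⟨ cong (λ z → (z ∸ i) % n) (swap n i e) ⟩
      (i + (n + e) ∸ i) % n    ≡⟨ cong (_% n) (m+n∸m≡n i (n + e)) ⟩
      (n + e) % n              ≡⟨ cong (_% n) (+-comm n e) ⟩
      (e + n) % n              ≡⟨ [m+n]%n≡m%n e n ⟩
      e % n                    ≡⟨ m<n⇒m%n≡m e<n ⟩
      e ∎
      where
      open ≡-Reasoning
      swap : ∀ n i e → n + (i + e) ≡ i + (n + e)
      swap = solve-∀

    diagonal-wrap : ∀ {i j e} → e < n → i + e ≡ n + j → diagonal i j ≡ e
    diagonal-wrap {i} {j} {e} e<n eq = begin
      (n + j ∸ i) % n  ≡⟨ cong (λ z → (z ∸ i) % n) eq ⟨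
      (i + e ∸ i) % n  ≡⟨ cong (_% n) (m+n∸m≡n i e) ⟩
      e % n            ≡⟨ m<n⇒m%n≡m e<n ⟩
      e ∎
      where open ≡-Reasoning

    +%-wrap : ∀ i {e j} → j < n → i + e ≡ n + j → (i + e) % n ≡ j
    +%-wrap i {e} {j} j<n eq =
      trans (cong (_% n) (trans eq (+-comm n j))) (trans ([m+n]%n≡m%n j n) (m<n⇒m%n≡m j<n))

    diagonal-% : ∀ {i d} → i < n → d < n → diagonal i ((i + d) % n) ≡ d
    diagonal-% {i} {d} i<n d<n with split< n (i + d)
    ... | inj₁ i+d<n     = trans (cong (diagonal i) (m<n⇒m%n≡m i+d<n)) (diagonal-+ i d<n)
    ... | inj₂ (j , eq) = trans (cong (diagonal i) (+%-wrap i j<n eq)) (diagonal-wrap {i} d<n eq)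
      where
      j<n : j < n
      j<n = +-cancelˡ-< n j n (subst (_< n + n) eq (+-mono-< i<n d<n))

    diagonal<n : ∀ i j → diagonal i j < n
    diagonal<n i j = m%n<n (n + j ∸ i) n

    diagonal-+% : ∀ {d j} → d < n → j < n → (diagonal d j + d) % n ≡ j
    diagonal-+% {d} {j} d<n j<n with split< d j
    ... | inj₂ (e , refl) = trans (cong (λ z → (z + d) % n) (diagonal-+ d e<n))
                              (trans (cong (_% n) (+-comm e d)) (m<n⇒m%n≡m j<n))
      where
      e<n : e < n
      e<n = ≤-<-trans (m≤n+m e d) j<n
    ... | inj₁ j<d = trans (cong (λ z → (z + d) % n) (diagonal-wrap {d} e<n d+e))
                       (+%-wrap e j<n (trans (+-comm e d) d+e))
      where
      e : ℕ
      e = n + j ∸ d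
      d+e : d + e ≡ n + j
      d+e = m+[n∸m]≡n (≤-trans (<⇒≤ d<n) (m≤m+n n j))
      e<n : e < n
      e<n = +-cancelˡ-< d e n (subst₂ _<_ (sym d+e) (+-comm n d) (+-monoʳ-< n j<d))

    -- Only triples with `d ≡ j - i` modulo `n` are read; passing all three indices lets an entry be
    -- described by its row or by its column, whichever is simpler.
    module Diagonals (T : ℕ → ℕ → ℕ → Maybe ℤ) where

      array : Array n
      array i j = T (diagonal (toℕ i) (toℕ j)) (toℕ i) (toℕ j)

      rowLine colLine : ℕ → List ℤ
      rowLine i = justs (λ d → T d i ((i + d) % n)) n
      colLine j = justs (λ d → T d (diagonal d j) j) n

      -- Diagonals 0, ..., n - i - 1 meet row `i` in columns i, ..., n - 1 and the others meet it in
      -- columns 0, ..., i - 1, so the natural order starts the diagonal order at `n - i`.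
      row-rotation : ∀ i → ∃[ xs ] ∃[ ys ] rowLine (toℕ i) ≡ xs ++ ys ×
        rowEntries array i ≡ ys ++ xs
      row-rotation fi = justs f (n ∸ i) , justs (f ∘ (n ∸ i +_)) i ,
        justs-++ f (n ∸ i) i (m∸n+n≡m i≤n) , entries
        where
        i = toℕ fi
        i≤n = <⇒≤ (toℕ<n fi)
        f : ℕ → Maybe ℤ
        f d = T d i ((i + d) % n)
        g : ℕ → Maybe ℤ
        g j = T (diagonal i j) i j
        before : ∀ {j} → j < i → g j ≡ f (n ∸ i + j)
        before {j} j<i = cong₂ (λ d j → T d i j)
          (diagonal-wrap {i} e<n eq) (sym (+%-wrap i (<-≤-trans j<i i≤n) eq))
          where
          eq : i + (n ∸ i + j) ≡ n + j
          eq = trans (sym (+-assoc i (n ∸ i) j)) (cong (_+ j) (m+[n∸m]≡n i≤n))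
          e<n : n ∸ i + j < n
          e<n = <-≤-trans (+-monoʳ-< (n ∸ i) j<i) (≤-reflexive (m∸n+n≡m i≤n))
        after : ∀ {e} → e < n ∸ i → g (i + e) ≡ f e
        after {e} e<n-i = cong₂ (λ d j → T d i j)
          (diagonal-+ i (<-≤-trans e<n-i (m∸n≤m n i)))
          (sym (m<n⇒m%n≡m (<-≤-trans (+-monoʳ-< i e<n-i) (≤-reflexive (m+[n∸m]≡n i≤n)))))
        entries : rowEntries array fi ≡ justs (f ∘ (n ∸ i +_)) i ++ justs f (n ∸ i)
        entries = begin
          catMaybes (map (array fi) (allFin n))
            ≡⟨ cong catMaybes (trans (map-tabulate id (array fi)) (tabulate-toℕ g n)) ⟩
          justs g n
            ≡⟨ justs-++ g i (n ∸ i) (m+[n∸m]≡n i≤n) ⟩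
          justs g i ++ justs (g ∘ (i +_)) (n ∸ i)
            ≡⟨ cong₂ _++_ (justs-cong i before) (justs-cong (n ∸ i) after) ⟩
          justs (f ∘ (n ∸ i +_)) i ++ justs f (n ∸ i) ∎
          where open ≡-Reasoning

      -- Down a column the diagonal index falls by one per row modulo `n`: rows 0, ..., j lie on
      -- diagonals j, ..., 0 and rows j + 1, ..., n - 1 on diagonals n - 1, ..., j + 1.
      col-reversal : ∀ j → ∃[ xs ] ∃[ ys ] colLine (toℕ j) ≡ xs ++ ys ×
        colEntries array j ≡ reverse (ys ++ xs)
      col-reversal fj = justs f (suc j) , justs (f ∘ (suc j +_)) w ,
        justs-++ f (suc j) w eqn , entries
        where
        j = toℕ fj
        w = n ∸ suc j
        eqn : suc j + w ≡ n
        eqn = m+[n∸m]≡n (toℕ<n fj)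
        f : ℕ → Maybe ℤ
        f d = T d (diagonal d j) j
        g : ℕ → Maybe ℤ
        g i = T (diagonal i j) i j
        g≡f : ∀ {i d} → i < n → d < n → i + d ≡ j ⊎ i + d ≡ n + j → g i ≡ f d
        g≡f {i} {d} i<n d<n (inj₁ eq) = cong₂ (λ d i → T d i j)
          (trans (cong (diagonal i) (sym eq)) (diagonal-+ i d<n))
          (sym (trans (cong (diagonal d) (trans (sym eq) (+-comm i d))) (diagonal-+ d i<n)))
        g≡f {i} {d} i<n d<n (inj₂ eq) = cong₂ (λ d i → T d i j)
          (diagonal-wrap {i} d<n eq) (sym (diagonal-wrap {d} i<n (trans (+-comm d i) eq)))
        before : ∀ {i} → i < suc j → g i ≡ f (suc j ∸ suc i)
        before {i} (s≤s i≤j) = g≡f (≤-<-trans i≤j (toℕ<n fj)) (≤-<-trans (m∸n≤m j i) (toℕ<n fj))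
          (inj₁ (m+[n∸m]≡n i≤j))
        after : ∀ {r} → r < w → g (suc j + r) ≡ f (suc j + (w ∸ suc r))
        after {r} r<w = g≡f
          (<-≤-trans (+-monoʳ-< (suc j) r<w) (≤-reflexive eqn))
          (<-≤-trans (+-monoʳ-< (suc j) (∸-monoʳ-< {w} {suc r} {0} z<s r<w)) (≤-reflexive eqn))
          (inj₂ (trans (lem j r (w ∸ suc r)) (trans (cong (λ z → suc j + z + j) (m+[n∸m]≡n r<w))
            (cong (_+ j) eqn))))
          where
          lem : ∀ j r v → suc j + r + (suc j + v) ≡ suc j + (suc r + v) + j
          lem = solve-∀
        entries : colEntries array fj ≡ reverse (justs (f ∘ (suc j +_)) w ++ justs f (suc j))
        entries = begin
          catMaybes (map (λ i → array i fj) (allFin n))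
            ≡⟨ cong catMaybes (trans (map-tabulate id (λ i → array i fj)) (tabulate-toℕ g n)) ⟩
          justs g n
            ≡⟨ justs-++ g (suc j) w eqn ⟩
          justs g (suc j) ++ justs (g ∘ (suc j +_)) w
            ≡⟨ cong₂ _++_ (justs-cong (suc j) before) (justs-cong w after) ⟩
          justs (λ i → f (suc j ∸ suc i)) (suc j) ++ justs (λ r → f (suc j + (w ∸ suc r))) w
            ≡⟨ cong₂ _++_ (justs-reverse f (suc j)) (justs-reverse (f ∘ (suc j +_)) w) ⟩
          reverse (justs f (suc j)) ++ reverse (justs (f ∘ (suc j +_)) w)
            ≡⟨ reverse-++ (justs (f ∘ (suc j +_)) w) (justs f (suc j)) ⟨
          reverse (justs (f ∘ (suc j +_)) w ++ justs f (suc j)) ∎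
          where open ≡-Reasoning

      -- Natural order and diagonal order differ only by rotation and reversal, so the lines may be
      -- checked in diagonal order; for coverage, too, a cell may be named by diagonal and row.
      heffter : ∀ k →
        (∀ {i} → i < n → ZeroSumSimple (suc (2 * n * k)) k (rowLine i)) →
        (∀ {j} → j < n → ZeroSumSimple (suc (2 * n * k)) k (colLine j)) →
        (∀ x → 1 ≤ x → x ≤ n * k → ∃[ d ] ∃[ i ] i < n × d < n ×
          (T d i ((i + d) % n) ≡ just (ℤ.+ x) ⊎
           T d i ((i + d) % n) ≡ just (ℤ.- (ℤ.+ x)))) →
        IsIntegerHeffter n k array × IsGloballySimple n k array
      heffter k rows cols cover =
        ( (λ i → let len , _ = row i in len)
        , (λ j → let len , _ = col j in len)
        , (λ i → let _ , Σ≡0 , _ = row i in Σ≡0)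
        , (λ j → let _ , Σ≡0 , _ = col j in Σ≡0)
        , occurs )
        , (λ i → let _ , _ , inc = row i in incongruent⇒simpleMod _ _ inc)
        , (λ j → let _ , _ , inc = col j in incongruent⇒simpleMod _ _ inc)
        where
        m = suc (2 * n * k)
        row : ∀ i → ZeroSumSimple m k (rowEntries array i)
        row i with row-rotation i
        ... | xs , ys , line≡ , entries≡ rewrite entries≡ =
          zeroSumSimple-rotate xs ys (subst (ZeroSumSimple m k) line≡ (rows (toℕ<n i)))
        col : ∀ j → ZeroSumSimple m k (colEntries array j)
        col j with col-reversal j
        ... | xs , ys , line≡ , entries≡ rewrite entries≡ = zeroSumSimple-reverse (ys ++ xs)
          (zeroSumSimple-rotate xs ys (subst (ZeroSumSimple m k) line≡ (cols (toℕ<n j))))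
        occurs : ∀ x → 1 ≤ x → x ≤ n * k → ∃[ i ] ∃[ j ] (array i j ≡ just (ℤ.+ x) ⊎
          array i j ≡ just (ℤ.- (ℤ.+ x)))
        occurs x 1≤x x≤nk with cover x 1≤x x≤nk
        ... | d , i , i<n , d<n , found =
          fromℕ< i<n , fromℕ< j<n ,
          subst (λ z → z ≡ just (ℤ.+ x) ⊎ z ≡ just (ℤ.- (ℤ.+ x))) (sym entry) found
          where
          j<n : (i + d) % n < n
          j<n = m%n<n (i + d) n
          entry : array (fromℕ< i<n) (fromℕ< j<n) ≡ T d i ((i + d) % n)
          entry rewrite toℕ-fromℕ< i<n | toℕ-fromℕ< j<n | diagonal-% i<n d<n = refl

-- The three diagonals that hold the numbers up to 3n.

module ThreeDiagonals where

  open PairedDiagonals using (_⊕_; _⊛_; 0≤+; diff; ≤-by; <-by)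
  open CyclicArrays using (split<; module Cyclic)
  open import Data.Nat as ℕ using (ℕ; zero; suc; z<s; s≤s)
  import Data.Nat.Properties as ℕₚ
  import Data.Nat.DivMod as ℕ
  open import Data.Integer hiding (NonZero; suc; _/_; _%_)
  open import Data.Integer.Properties
  open import Data.Integer.Tactic.RingSolver using (solve-∀)
  open import Data.Nat.Tactic.RingSolver using () renaming (solve-∀ to ℕ-solve-∀)
  open import Data.Product using (_×_; _,_; ∃-syntax)
  open import Data.Sum using (_⊎_; inj₁; inj₂)
  open import Relation.Binary.PropositionalEquality hiding ([_])
  open import Relation.Nullary using (contradiction)
  open import Function using (_∘_)

  -- `g` restarts at 0 after the first `a` places, so each section has a formula in its own local
  -- index.
  append : ∀ {X : Set} → ℕ → (ℕ → X) → (ℕ → X) → ℕ → X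
  append zero    f g d       = g d
  append (suc a) f g zero    = f 0
  append (suc a) f g (suc d) = append a (f ∘ suc) g d

  append-< : ∀ {X : Set} {a d} (f g : ℕ → X) → d ℕ.< a → append a f g d ≡ f d
  append-< {a = suc a} {zero}  f g _         = refl
  append-< {a = suc a} {suc d} f g (s≤s d<a) = append-< (f ∘ suc) g d<a

  append-+ : ∀ {X : Set} a {d} (f g : ℕ → X) → append a f g (a ℕ.+ d) ≡ g d
  append-+ zero    f g = refl
  append-+ (suc a) f g = append-+ a (f ∘ suc) g

  half : ∀ y → ∃[ m ] (y ≡ m ℕ.+ m ⊎ y ≡ suc (m ℕ.+ m))
  half zero = 0 , inj₁ refl
  half (suc y) with half y
  ... | m , inj₁ refl = m , inj₂ refl
  ... | m , inj₂ refl = suc m , inj₁ (cong suc (sym (ℕₚ.+-suc m m)))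

  module Alpha (q : ℕ) (0<q : 0 ℕ.< q) where

    open Cyclic (4 ℕ.* q)

    u : ℕ
    u = suc (q ℕ.+ q)

    -- `K` is `4n + 1`, and `n′` is `n` written as a polynomial in `Q` for the ring identities.
    Q K n′ : ℤ
    Q  = + q
    K  = + 16 * Q + + 5
    n′ = + 4 * Q + 1ℤ

    +n≡n′ : + n ≡ n′
    +n≡n′ = trans (+-comm 1ℤ (+ (4 ℕ.* q))) (cong (λ z → z + 1ℤ) (pos-* 4 q))

    -- α(i) is the value of vertex t = 2i mod n of the path, which is 2n + ℓ(t) for even t and
    -- 2n + 1 - ℓ(t) for odd t, where ℓ is the graceful labelling
    -- q+1, 3q+2, q, 3q+3, …, 4q+1, 1, 2q+1, 2q+2, 2q, 2q+3, …, q+2, 3q+1.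
    α₁ α₂ α₃ α₄ α : ℕ → ℤ
    α₁ m = + 9 * Q + + 3 - + m
    α₂ m = + 10 * Q + + 4 + + m
    α₃ m = + 5 * Q + 1ℤ - + m
    α₄ m = + 6 * Q + + 2 + + m
    α = append (suc q) α₁ (append q α₂ (append q α₃ α₄))

    -- The bracketing follows the nesting of `append` in `α`, so that `append-+` applies directly.
    second third fourth : ℕ → ℕ
    second m = suc q ℕ.+ m
    third  m = suc q ℕ.+ (q ℕ.+ m)
    fourth m = suc q ℕ.+ (q ℕ.+ (q ℕ.+ m))

    α-first : ∀ {m} → m ℕ.≤ q → α m ≡ α₁ m
    α-first m≤q = append-< α₁ (append q α₂ (append q α₃ α₄)) (s≤s m≤q)

    α-second : ∀ {m} → m ℕ.< q → α (second m) ≡ α₂ m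
    α-second m<q = trans (append-+ (suc q) α₁ (append q α₂ (append q α₃ α₄)))
      (append-< α₂ (append q α₃ α₄) m<q)

    α-third : ∀ {m} → m ℕ.< q → α (third m) ≡ α₃ m
    α-third m<q = trans (append-+ (suc q) α₁ (append q α₂ (append q α₃ α₄)))
      (trans (append-+ q α₂ (append q α₃ α₄)) (append-< α₃ α₄ m<q))

    α-fourth : ∀ m → α (fourth m) ≡ α₄ m
    α-fourth m = trans (append-+ (suc q) α₁ (append q α₂ (append q α₃ α₄)))
      (trans (append-+ q α₂ (append q α₃ α₄)) (append-+ q α₃ α₄))

    fourth-q : fourth q ≡ n
    fourth-q = lem q
      where
      lem : ∀ q → suc q ℕ.+ (q ℕ.+ (q ℕ.+ q)) ≡ suc (4 ℕ.* q)
      lem = ℕ-solve-∀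

    fourth<n : ∀ {m} → m ℕ.< q → fourth m ℕ.< n
    fourth<n {m} m<q = subst (fourth m ℕ.<_) fourth-q
      (ℕₚ.+-monoʳ-< (suc q) (ℕₚ.+-monoʳ-< q (ℕₚ.+-monoʳ-< q m<q)))

    third<n : ∀ {m} → m ℕ.< q → third m ℕ.< n
    third<n {m} m<q = ℕₚ.≤-<-trans
      (ℕₚ.+-monoʳ-≤ (suc q) (ℕₚ.+-monoʳ-≤ q (ℕₚ.m≤n+m m q))) (fourth<n m<q)

    second<n : ∀ {m} → m ℕ.< q → second m ℕ.< n
    second<n {m} m<q = ℕₚ.≤-<-trans (ℕₚ.+-monoʳ-≤ (suc q) (ℕₚ.m≤n+m m q)) (third<n m<q)

    first<n : ∀ {m} → m ℕ.≤ q → m ℕ.< n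
    first<n m≤q = ℕₚ.≤-<-trans m≤q
      (ℕₚ.≤-<-trans (ℕₚ.m≤m+n q 0) (ℕₚ.<-trans (ℕₚ.n<1+n _) (second<n 0<q)))

    data Quarter : ℕ → Set where
      inFirst  : ∀ {m} → m ℕ.≤ q → Quarter m
      inSecond : ∀ {m} → m ℕ.< q → Quarter (second m)
      inThird  : ∀ {m} → m ℕ.< q → Quarter (third m)
      inFourth : ∀ {m} → m ℕ.< q → Quarter (fourth m)

    quarter : ∀ {i} → i ℕ.< n → Quarter i
    quarter {i} i<n with split< (suc q) i
    ... | inj₁ (s≤s i≤q) = inFirst i≤q
    ... | inj₂ (m , refl) with split< q m
    ...   | inj₁ m<q = inSecond m<q
    ...   | inj₂ (m , refl) with split< q m
    ...     | inj₁ m<q = inThird m<q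
    ...     | inj₂ (m , refl) = inFourth (ℕₚ.+-cancelˡ-< q m q (ℕₚ.+-cancelˡ-< q (q ℕ.+ m) (q ℕ.+ q)
                (ℕₚ.+-cancelˡ-< (suc q) _ _ (subst (fourth m ℕ.<_) (sym fourth-q) i<n))))

    α-lower : ∀ {i} → i ℕ.< n → 1ℤ + n′ ≤ α i
    α-lower i<n with quarter i<n
    ... | inFirst {m} m≤q rewrite α-first m≤q =
      ≤-by (diff (+≤+ m≤q) ⊕ 0≤+ {4} ⊛ 0≤+ {q} ⊕ 0≤+ {1}) (lem Q (+ m))
      where
      lem : ∀ Q M → Q - M + + 4 * Q + 1ℤ ≡ + 9 * Q + + 3 - M - (1ℤ + (+ 4 * Q + 1ℤ))
      lem = solve-∀
    ... | inSecond {m} m<q rewrite α-second m<q =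
      ≤-by (0≤+ {m} ⊕ 0≤+ {6} ⊛ 0≤+ {q} ⊕ 0≤+ {2}) (lem Q (+ m))
      where
      lem : ∀ Q M → M + + 6 * Q + + 2 ≡ + 10 * Q + + 4 + M - (1ℤ + (+ 4 * Q + 1ℤ))
      lem = solve-∀
    ... | inThird {m} m<q rewrite α-third m<q = ≤-by (diff (+≤+ m<q)) (lem Q (+ m))
      where
      lem : ∀ Q M → Q - (1ℤ + M) ≡ + 5 * Q + 1ℤ - M - (1ℤ + (+ 4 * Q + 1ℤ))
      lem = solve-∀
    ... | inFourth {m} m<q rewrite α-fourth m =
      ≤-by (0≤+ {m} ⊕ 0≤+ {2} ⊛ 0≤+ {q}) (lem Q (+ m))
      where
      lem : ∀ Q M → M + + 2 * Q ≡ + 6 * Q + + 2 + M - (1ℤ + (+ 4 * Q + 1ℤ))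
      lem = solve-∀

    -- Adding `u` moves vertex `t = 2i` of the path to `t + 1`, so these are the edges of the path
    -- together with `second→first`, which joins the last vertex to the first. The quarters have
    -- lengths q + 1, q, q, q, whence the boundary cases.
    data Shifted : ℕ → ℕ → Set where
      first→third    : ∀ {m} → m ℕ.< q → Shifted m (third m)
      first→fourth   : Shifted q (fourth 0)
      second→fourth  : ∀ {m} → suc m ℕ.< q → Shifted (second m) (fourth (suc m))
      second→first   : ∀ {m} → suc m ≡ q → Shifted (second m) 0
      third→first    : ∀ {m} → m ℕ.< q → Shifted (third m) (suc m)
      fourth→second  : ∀ {m} → m ℕ.< q → Shifted (fourth m) (second m)

    shifted-% : ∀ {i j} → Shifted i j → (i ℕ.+ u) ℕ.% n ≡ j
    shifted-% (first→third {m} m<q) =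
      trans (cong (ℕ._% n) (lem q m)) (ℕ.m<n⇒m%n≡m (third<n m<q))
      where
      lem : ∀ q m → m ℕ.+ suc (q ℕ.+ q) ≡ suc q ℕ.+ (q ℕ.+ m)
      lem = ℕ-solve-∀
    shifted-% first→fourth =
      trans (cong (ℕ._% n) (lem q)) (ℕ.m<n⇒m%n≡m (fourth<n 0<q))
      where
      lem : ∀ q → q ℕ.+ suc (q ℕ.+ q) ≡ suc q ℕ.+ (q ℕ.+ (q ℕ.+ 0))
      lem = ℕ-solve-∀
    shifted-% (second→fourth {m} m<q) =
      trans (cong (ℕ._% n) (lem q m)) (ℕ.m<n⇒m%n≡m (fourth<n m<q))
      where
      lem : ∀ q m → suc q ℕ.+ m ℕ.+ suc (q ℕ.+ q) ≡ suc q ℕ.+ (q ℕ.+ (q ℕ.+ suc m))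
      lem = ℕ-solve-∀
    shifted-% (second→first {m} refl) = +%-wrap (second m) z<s (lem m)
      where
      lem : ∀ m → suc (suc m) ℕ.+ m ℕ.+ suc (suc m ℕ.+ suc m) ≡ suc (4 ℕ.* suc m) ℕ.+ 0
      lem = ℕ-solve-∀
    shifted-% (third→first {m} m<q) = +%-wrap (third m) (first<n m<q) (lem q m)
      where
      lem : ∀ q m → suc q ℕ.+ (q ℕ.+ m) ℕ.+ suc (q ℕ.+ q) ≡ suc (4 ℕ.* q) ℕ.+ suc m
      lem = ℕ-solve-∀
    shifted-% (fourth→second {m} m<q) = +%-wrap (fourth m) (second<n m<q) (lem q m)
      where
      lem : ∀ q m → suc q ℕ.+ (q ℕ.+ (q ℕ.+ m)) ℕ.+ suc (q ℕ.+ q) ≡ suc (4 ℕ.* q) ℕ.+ (suc q ℕ.+ m)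
      lem = ℕ-solve-∀

    shifted : ∀ {i} → i ℕ.< n → ∃[ j ] Shifted i j
    shifted i<n with quarter i<n
    ... | inFirst m≤q with ℕₚ.m≤n⇒m<n∨m≡n m≤q
    ...   | inj₁ m<q  = _ , first→third m<q
    ...   | inj₂ refl = _ , first→fourth
    shifted i<n | inSecond m<q with ℕₚ.m≤n⇒m<n∨m≡n m<q
    ...   | inj₁ 1+m<q = _ , second→fourth 1+m<q
    ...   | inj₂ 1+m≡q = _ , second→first 1+m≡q
    shifted i<n | inThird m<q  = _ , third→first m<q
    shifted i<n | inFourth m<q = _ , fourth→second m<q

    shift : ∀ {i} → i ℕ.< n → Shifted i ((i ℕ.+ u) ℕ.% n)
    shift i<n with shifted i<n
    ... | j , i→j = subst (Shifted _) (sym (shifted-% i→j)) i→j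

    -- Along an edge of the path the offsets `2n` and `2n + 1` add up to `K`, leaving the label at
    -- the odd vertex minus the label at the even one. On the closing pair both vertices are even,
    -- and the label sum `n + 1` gives `- n`.
    β : ℕ → ℕ → ℤ
    β i j = K - α i - α j

    -- In absolute value: the odd and even numbers below 2q from the fourth and second quarters,
    -- then 2q, then the odd and even numbers from 2q + 1 to 4q from the first and third quarters,
    -- and n from the closing pair.
    β-value : ∀ {i j} → Shifted i j → ℤ
    β-value (first→third {m} _)   = + 2 * Q + 1ℤ + + 2 * + m
    β-value first→fourth          = + 2 * Q
    β-value (second→fourth {m} _) = - (+ 2 + + 2 * + m)
    β-value (second→first _)      = - n′
    β-value (third→first {m} _)   = + 2 * Q + + 2 + + 2 * + m
    β-value (fourth→second {m} _) = - (1ℤ + + 2 * + m)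

    β≡β-value : ∀ {i j} (i→j : Shifted i j) → β i j ≡ β-value i→j
    β≡β-value (first→third {m} m<q) rewrite α-first (ℕₚ.<⇒≤ m<q) | α-third m<q = lem Q (+ m)
      where
      lem : ∀ Q M → + 16 * Q + + 5 - (+ 9 * Q + + 3 - M) - (+ 5 * Q + 1ℤ - M)
        ≡ + 2 * Q + 1ℤ + + 2 * M
      lem = solve-∀
    β≡β-value first→fourth rewrite α-first (ℕₚ.≤-refl {q}) | α-fourth 0 = lem Q
      where
      lem : ∀ Q → + 16 * Q + + 5 - (+ 9 * Q + + 3 - Q) - (+ 6 * Q + + 2 + 0ℤ) ≡ + 2 * Q
      lem = solve-∀
    β≡β-value (second→fourth {m} m<q) rewrite α-second (ℕₚ.<⇒≤ m<q) | α-fourth (suc m) = lem Q (+ m)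
      where
      lem : ∀ Q M → + 16 * Q + + 5 - (+ 10 * Q + + 4 + M) - (+ 6 * Q + + 2 + (1ℤ + M))
        ≡ - (+ 2 + + 2 * M)
      lem = solve-∀
    β≡β-value (second→first {m} refl) rewrite α-second (ℕₚ.n<1+n m) = lem (+ m)
      where
      lem : ∀ M → + 16 * (1ℤ + M) + + 5 - (+ 10 * (1ℤ + M) + + 4 + M) - (+ 9 * (1ℤ + M) + + 3 - 0ℤ)
        ≡ - (+ 4 * (1ℤ + M) + 1ℤ)
      lem = solve-∀
    β≡β-value (third→first {m} m<q) rewrite α-third m<q | α-first m<q = lem Q (+ m)
      where
      lem : ∀ Q M → + 16 * Q + + 5 - (+ 5 * Q + 1ℤ - M) - (+ 9 * Q + + 3 - (1ℤ + M))
        ≡ + 2 * Q + + 2 + + 2 * M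
      lem = solve-∀
    β≡β-value (fourth→second {m} m<q) rewrite α-fourth m | α-second m<q = lem Q (+ m)
      where
      lem : ∀ Q M → + 16 * Q + + 5 - (+ 6 * Q + + 2 + M) - (+ 10 * Q + + 4 + M)
        ≡ - (1ℤ + + 2 * M)
      lem = solve-∀

    Small : ℤ → Set
    Small b = (- n′ ≤ b × b ≤ n′) × b ≢ 0ℤ

    small-positive : ∀ {b} → 0ℤ < b → b ≤ n′ → Small b
    small-positive 0<b b≤n′ = (≤-trans (neg-mono-≤ 0≤n′) (<⇒≤ 0<b) , b≤n′) , ≢-sym (<⇒≢ 0<b)
      where
      0≤n′ : 0ℤ ≤ n′
      0≤n′ = 0≤+ {4} ⊛ 0≤+ {q} ⊕ 0≤+ {1}

    small-negative : ∀ {b} → 0ℤ < b → b ≤ n′ → Small (- b)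
    small-negative 0<b b≤n′ with small-positive 0<b b≤n′
    ... | (-n≤b , b≤n) , b≢0 =
      (neg-mono-≤ b≤n , subst (_ ≤_) (neg-involutive n′) (neg-mono-≤ -n≤b)) , b≢0 ∘ neg-injective

    β-small : ∀ {i j} → Shifted i j → Small (β i j)
    β-small {i} {j} i→j = subst Small (sym (β≡β-value i→j)) (value-small i→j)
      where
      value-small : ∀ {i j} (i→j : Shifted i j) → Small (β-value i→j)
      value-small (first→third {m} m<q) = small-positive
        (<-by (0≤+ {2} ⊛ 0≤+ {q} ⊕ 0≤+ {2} ⊛ 0≤+ {m}) (lo Q (+ m)))
        (≤-by (0≤+ {2} ⊛ diff (+≤+ m<q) ⊕ 0≤+ {2}) (hi Q (+ m)))
        where
        lo : ∀ Q M → + 2 * Q + + 2 * M ≡ + 2 * Q + 1ℤ + + 2 * M - (1ℤ + 0ℤ)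
        lo = solve-∀
        hi : ∀ Q M → + 2 * (Q - (1ℤ + M)) + + 2 ≡ + 4 * Q + 1ℤ - (+ 2 * Q + 1ℤ + + 2 * M)
        hi = solve-∀
      value-small first→fourth = small-positive
        (<-by (0≤+ {2} ⊛ diff (+≤+ 0<q) ⊕ 0≤+ {1}) (lo Q))
        (≤-by (0≤+ {2} ⊛ 0≤+ {q} ⊕ 0≤+ {1}) (hi Q))
        where
        lo : ∀ Q → + 2 * (Q - 1ℤ) + 1ℤ ≡ + 2 * Q - (1ℤ + 0ℤ)
        lo = solve-∀
        hi : ∀ Q → + 2 * Q + 1ℤ ≡ + 4 * Q + 1ℤ - + 2 * Q
        hi = solve-∀
      value-small (second→fourth {m} m<q) = small-negative
        (<-by (0≤+ {1} ⊕ 0≤+ {2} ⊛ 0≤+ {m}) (lo (+ m)))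
        (≤-by (0≤+ {2} ⊛ diff (+≤+ m<q) ⊕ 0≤+ {2} ⊛ 0≤+ {q} ⊕ 0≤+ {3}) (hi Q (+ m)))
        where
        lo : ∀ M → 1ℤ + + 2 * M ≡ + 2 + + 2 * M - (1ℤ + 0ℤ)
        lo = solve-∀
        hi : ∀ Q M → + 2 * (Q - (+ 2 + M)) + + 2 * Q + + 3 ≡ + 4 * Q + 1ℤ - (+ 2 + + 2 * M)
        hi = solve-∀
      value-small (second→first _) = small-negative
        (<-by (0≤+ {4} ⊛ 0≤+ {q}) (lo Q)) ≤-refl
        where
        lo : ∀ Q → + 4 * Q ≡ + 4 * Q + 1ℤ - (1ℤ + 0ℤ)
        lo = solve-∀
      value-small (third→first {m} m<q) = small-positive
        (<-by (0≤+ {2} ⊛ 0≤+ {q} ⊕ 0≤+ {1} ⊕ 0≤+ {2} ⊛ 0≤+ {m}) (lo Q (+ m)))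
        (≤-by (0≤+ {2} ⊛ diff (+≤+ m<q) ⊕ 0≤+ {1}) (hi Q (+ m)))
        where
        lo : ∀ Q M → + 2 * Q + 1ℤ + + 2 * M ≡ + 2 * Q + + 2 + + 2 * M - (1ℤ + 0ℤ)
        lo = solve-∀
        hi : ∀ Q M → + 2 * (Q - (1ℤ + M)) + 1ℤ ≡ + 4 * Q + 1ℤ - (+ 2 * Q + + 2 + + 2 * M)
        hi = solve-∀
      value-small (fourth→second {m} m<q) = small-negative
        (<-by (0≤+ {2} ⊛ 0≤+ {m}) (lo (+ m)))
        (≤-by (0≤+ {2} ⊛ diff (+≤+ m<q) ⊕ 0≤+ {2} ⊛ 0≤+ {q} ⊕ 0≤+ {2}) (hi Q (+ m)))
        where
        lo : ∀ M → + 2 * M ≡ 1ℤ + + 2 * M - (1ℤ + 0ℤ)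
        lo = solve-∀
        hi : ∀ Q M → + 2 * (Q - (1ℤ + M)) + + 2 * Q + + 2 ≡ + 4 * Q + 1ℤ - (1ℤ + + 2 * M)
        hi = solve-∀

    plus-minus : ℤ → ℕ → Set
    plus-minus z x = z ≡ + x ⊎ z ≡ - + x

    β-% : ∀ {i j z} (i→j : Shifted i j) → β-value i→j ≡ z → β i ((i ℕ.+ u) ℕ.% n) ≡ z
    β-% {i} i→j eq = trans (cong (β i) (shifted-% i→j)) (trans (β≡β-value i→j) eq)

    -- The parity of `suc y` and its size relative to `2q` determine the edge; `2q` and `n` are the
    -- two exceptional values.
    β-covers : ∀ {y} → y ℕ.< n → ∃[ i ] i ℕ.< n × plus-minus (β i ((i ℕ.+ u) ℕ.% n)) (suc y)
    β-covers {y} y<n with half y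
    ... | m , inj₁ refl with split< q m
    ...   | inj₁ m<q = fourth m , fourth<n m<q , inj₂ (β-% (fourth→second m<q) (lem (+ m)))
      where
      lem : ∀ M → - (1ℤ + + 2 * M) ≡ - (1ℤ + (M + M))
      lem = solve-∀
    ...   | inj₂ (m , refl) with split< q m
    ...     | inj₁ m<q = m , first<n (ℕₚ.<⇒≤ m<q) , inj₁ (β-% (first→third m<q) (lem Q (+ m)))
      where
      lem : ∀ Q M → + 2 * Q + 1ℤ + + 2 * M ≡ 1ℤ + (Q + M + (Q + M))
      lem = solve-∀
    ...     | inj₂ (suc m , refl) = contradiction
      (subst (n ℕ.≤_) (lem q m) (ℕₚ.m≤m+n n _)) (ℕₚ.<⇒≱ y<n)
      where
      lem : ∀ q m → suc (4 ℕ.* q) ℕ.+ (m ℕ.+ suc m)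
        ≡ q ℕ.+ (q ℕ.+ suc m) ℕ.+ (q ℕ.+ (q ℕ.+ suc m))
      lem = ℕ-solve-∀
    ...     | inj₂ (zero , refl) with ℕₚ.m≤n⇒∃[o]m+o≡n 0<q
    ...       | m , 1+m≡q = second m , second<n (subst (m ℕ.<_) 1+m≡q (ℕₚ.n<1+n m)) ,
      inj₂ (β-% (second→first 1+m≡q) (lem Q))
      where
      lem : ∀ Q → - (+ 4 * Q + 1ℤ) ≡ - (1ℤ + (Q + (Q + 0ℤ) + (Q + (Q + 0ℤ))))
      lem = solve-∀
    -- Here `suc y` is `2 * suc m`, so it is `suc m` that is compared with `q`.
    β-covers {y} y<n | m , inj₂ refl with split< q (suc m)
    ...   | inj₁ 1+m<q = second m , second<n (ℕₚ.<⇒≤ 1+m<q) ,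
      inj₂ (β-% (second→fourth 1+m<q) (lem (+ m)))
      where
      lem : ∀ M → - (+ 2 + + 2 * M) ≡ - (+ 2 + (M + M))
      lem = solve-∀
    ...   | inj₂ (zero , 1+m≡q) = q , first<n ℕₚ.≤-refl ,
      inj₁ (β-% first→fourth (trans
        (cong (λ z → + 2 * + z) (trans (sym (ℕₚ.+-identityʳ q)) (sym 1+m≡q))) (lem (+ m))))
      where
      lem : ∀ M → + 2 * (1ℤ + M) ≡ + 2 + (M + M)
      lem = solve-∀
    ...   | inj₂ (suc r , 1+m≡q+r) with ℕₚ.suc-injective (trans 1+m≡q+r (ℕₚ.+-suc q r))
    ...     | refl with split< q r
    ...       | inj₁ r<q = third r , third<n r<q , inj₁ (β-% (third→first r<q) (lem Q (+ r)))
      where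
      lem : ∀ Q M → + 2 * Q + + 2 + + 2 * M ≡ + 2 + (Q + M + (Q + M))
      lem = solve-∀
    ...       | inj₂ (r , refl) = contradiction
      (subst (n ℕ.≤_) (lem q r) (ℕₚ.m≤m+n n _)) (ℕₚ.<⇒≱ y<n)
      where
      lem : ∀ q m → suc (4 ℕ.* q) ℕ.+ (m ℕ.+ m)
        ≡ suc (q ℕ.+ (q ℕ.+ m) ℕ.+ (q ℕ.+ (q ℕ.+ m)))
      lem = ℕ-solve-∀

    -- The index counted from the other end of a quarter, with its integer value in a form that ring
    -- identities can use.
    complement : ∀ {y} → y ℕ.< q → ∃[ m ] m ℕ.< q × + m ≡ Q - + suc y
    complement {y} y<q with ℕₚ.m≤n⇒∃[o]m+o≡n y<q
    ... | m , y+m≡q = m , subst (m ℕ.<_) y+m≡q (s≤s (ℕₚ.m≤n+m m y)) ,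
      trans (lem (+ suc y) (+ m)) (cong (λ z → + z - + suc y) y+m≡q)
      where
      lem : ∀ Y M → M ≡ Y + M - Y
      lem = solve-∀

    -- A label `ℓ` yields the value `2n + ℓ` or `2n + 1 - ℓ`, and subtraction from `K` exchanges the
    -- two, so `α` and `K - α` together run through n + 1, ..., 3n. In increasing order this range
    -- splits into eight segments, filled alternately by `α` and `α - K` up to sign; the two middle
    -- ones, from the first quarter, have q + 1 values and the others q.
    α-covers : ∀ {y} → y ℕ.< n ℕ.+ n →
      ∃[ i ] i ℕ.< n × (α i ≡ + (suc n ℕ.+ y) ⊎ α i - K ≡ - + (suc n ℕ.+ y))
    α-covers {y} y<2n = cover
      where
      Covered : ℕ → Set
      Covered y = ∃[ i ] i ℕ.< n × (α i ≡ + (suc n ℕ.+ y) ⊎ α i - K ≡ - + (suc n ℕ.+ y))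

      +x : ∀ y → + (suc n ℕ.+ y) ≡ + 4 * Q + + 2 + + y
      +x y = trans (cong (λ z → + 2 + z + + y) (pos-* 4 q)) (lem Q (+ y))
        where
        lem : ∀ Q Y → + 2 + + 4 * Q + Y ≡ + 4 * Q + + 2 + Y
        lem = solve-∀

      asα : ∀ {y i a} → i ℕ.< n → α i ≡ a → a ≡ + 4 * Q + + 2 + + y → Covered y
      asα {y} i<n αi≡a eq = _ , i<n , inj₁ (trans αi≡a (trans eq (sym (+x y))))

      asγ : ∀ {y i a} → i ℕ.< n → α i ≡ a → a - K ≡ - (+ 4 * Q + + 2 + + y) → Covered y
      asγ {y} i<n αi≡a eq =
        _ , i<n , inj₂ (trans (cong (λ z → z - K) αi≡a) (trans eq (cong -_ (sym (+x y)))))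

      by-third : ∀ {y} → y ℕ.< q → Covered y
      by-third {y} y<q with complement y<q
      ... | m , m<q , m≡ = asα (third<n m<q) (α-third m<q)
        (trans (cong (λ z → + 5 * Q + 1ℤ - z) m≡) (lem Q (+ y)))
        where
        lem : ∀ Q Y → + 5 * Q + 1ℤ - (Q - (1ℤ + Y)) ≡ + 4 * Q + + 2 + Y
        lem = solve-∀

      by-γsecond : ∀ {y} → y ℕ.< q → Covered (q ℕ.+ y)
      by-γsecond {y} y<q with complement y<q
      ... | m , m<q , m≡ = asγ (second<n m<q) (α-second m<q)
        (trans (cong (λ z → + 10 * Q + + 4 + z - K) m≡) (lem Q (+ y)))
        where
        lem : ∀ Q Y → + 10 * Q + + 4 + (Q - (1ℤ + Y)) - (+ 16 * Q + + 5)
          ≡ - (+ 4 * Q + + 2 + (Q + Y))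
        lem = solve-∀

      by-fourth : ∀ {y} → y ℕ.< q → Covered (q ℕ.+ (q ℕ.+ y))
      by-fourth {y} y<q = asα (fourth<n y<q) (α-fourth y) (lem Q (+ y))
        where
        lem : ∀ Q Y → + 6 * Q + + 2 + Y ≡ + 4 * Q + + 2 + (Q + (Q + Y))
        lem = solve-∀

      by-γfirst : ∀ {y} → y ℕ.≤ q → Covered (q ℕ.+ (q ℕ.+ (q ℕ.+ y)))
      by-γfirst {y} y≤q = asγ (first<n y≤q) (α-first y≤q) (lem Q (+ y))
        where
        lem : ∀ Q Y → + 9 * Q + + 3 - Y - (+ 16 * Q + + 5) ≡ - (+ 4 * Q + + 2 + (Q + (Q + (Q + Y))))
        lem = solve-∀

      by-first : ∀ {y} → y ℕ.≤ q → Covered (q ℕ.+ (q ℕ.+ (q ℕ.+ (suc q ℕ.+ y))))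
      -- The first quarter has `q + 1` values, so the reversed index is `q - y`; `q` is rewritten as
      -- `y + m` to leave a ring identity.
      by-first {y} y≤q with ℕₚ.m≤n⇒∃[o]m+o≡n y≤q
      ... | m , y+m≡q = asα (first<n m≤q) (α-first m≤q)
        (trans (cong (λ z → + 9 * z + + 3 - + m) (cong +_ (sym y+m≡q)))
          (trans (lem (+ y) (+ m))
            (cong (λ q → + 4 * + q + + 2 + + (q ℕ.+ (q ℕ.+ (q ℕ.+ (suc q ℕ.+ y))))) y+m≡q)))
        where
        m≤q : m ℕ.≤ q
        m≤q = subst (m ℕ.≤_) y+m≡q (ℕₚ.m≤n+m m y)
        lem : ∀ Y M → + 9 * (Y + M) + + 3 - M
          ≡ + 4 * (Y + M) + + 2 + (Y + M + (Y + M + (Y + M + (1ℤ + (Y + M) + Y))))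
        lem = solve-∀

      by-γfourth : ∀ {y} → y ℕ.< q → Covered (q ℕ.+ (q ℕ.+ (q ℕ.+ (suc q ℕ.+ (suc q ℕ.+ y)))))
      by-γfourth {y} y<q with complement y<q
      ... | m , m<q , m≡ = asγ (fourth<n m<q) (α-fourth m)
        (trans (cong (λ z → + 6 * Q + + 2 + z - K) m≡) (lem Q (+ y)))
        where
        lem : ∀ Q Y → + 6 * Q + + 2 + (Q - (1ℤ + Y)) - (+ 16 * Q + + 5)
          ≡ - (+ 4 * Q + + 2 + (Q + (Q + (Q + (1ℤ + Q + (1ℤ + Q + Y))))))
        lem = solve-∀

      by-second : ∀ {y} → y ℕ.< q →
        Covered (q ℕ.+ (q ℕ.+ (q ℕ.+ (suc q ℕ.+ (suc q ℕ.+ (q ℕ.+ y))))))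
      by-second {y} y<q = asα (second<n y<q) (α-second y<q) (lem Q (+ y))
        where
        lem : ∀ Q Y → + 10 * Q + + 4 + Y
          ≡ + 4 * Q + + 2 + (Q + (Q + (Q + (1ℤ + Q + (1ℤ + Q + (Q + Y))))))
        lem = solve-∀

      by-γthird : ∀ {y} → y ℕ.< q →
        Covered (q ℕ.+ (q ℕ.+ (q ℕ.+ (suc q ℕ.+ (suc q ℕ.+ (q ℕ.+ (q ℕ.+ y)))))))
      by-γthird {y} y<q = asγ (third<n y<q) (α-third y<q) (lem Q (+ y))
        where
        lem : ∀ Q Y → + 5 * Q + 1ℤ - Y - (+ 16 * Q + + 5)
          ≡ - (+ 4 * Q + + 2 + (Q + (Q + (Q + (1ℤ + Q + (1ℤ + Q + (Q + (Q + Y))))))))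
        lem = solve-∀

      too-large : ∀ y →
        n ℕ.+ n ℕ.≤ q ℕ.+ (q ℕ.+ (q ℕ.+ (suc q ℕ.+ (suc q ℕ.+ (q ℕ.+ (q ℕ.+ (q ℕ.+ y)))))))
      too-large y = subst (n ℕ.+ n ℕ.≤_) (lem q y) (ℕₚ.m≤m+n (n ℕ.+ n) y)
        where
        lem : ∀ q y → suc (4 ℕ.* q) ℕ.+ suc (4 ℕ.* q) ℕ.+ y
          ≡ q ℕ.+ (q ℕ.+ (q ℕ.+ (suc q ℕ.+ (suc q ℕ.+ (q ℕ.+ (q ℕ.+ (q ℕ.+ y)))))))
        lem = ℕ-solve-∀

      cover : Covered y
      cover with split< q y
      ... | inj₁ y<q = by-third y<q
      ... | inj₂ (y , refl) with split< q y
      ...  | inj₁ y<q = by-γsecond y<q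
      ...  | inj₂ (y , refl) with split< q y
      ...   | inj₁ y<q = by-fourth y<q
      ...   | inj₂ (y , refl) with split< (suc q) y
      ...    | inj₁ (s≤s y≤q) = by-γfirst y≤q
      ...    | inj₂ (y , refl) with split< (suc q) y
      ...     | inj₁ (s≤s y≤q) = by-first y≤q
      ...     | inj₂ (y , refl) with split< q y
      ...      | inj₁ y<q = by-γfourth y<q
      ...      | inj₂ (y , refl) with split< q y
      ...       | inj₁ y<q = by-second y<q
      ...       | inj₂ (y , refl) with split< q y
      ...        | inj₁ y<q = by-γthird y<q
      ...        | inj₂ (y , refl) = contradiction (too-large y) (ℕₚ.<⇒≱ y<2n)

-- Assembly of the array and coverage of all numbers.

module Arrays where

  open PartialSums
  open PairedDiagonals using (interleave; interleave-cong; ≤-by; diff; module Line)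
  open CyclicArrays using (justs; justs-++; justs-cong; justs-nothing; split<; module Cyclic)
  open ThreeDiagonals using (append; append-<; append-+; module Alpha)
  open import Data.Nat as ℕ using (ℕ; zero; suc; z<s; s<s; s≤s; z≤n; _<_; _%_; _/_)
  import Data.Nat.Properties as ℕₚ
  import Data.Nat.DivMod as ℕ
  open import Data.Integer hiding (NonZero; suc; _/_; _%_; _<_)
  open import Data.Integer.Properties hiding (_<?_; _≤?_)
  open import Data.Integer.Tactic.RingSolver using (solve-∀)
  open import Data.Nat.Tactic.RingSolver using () renaming (solve-∀ to ℕ-solve-∀)
  open import Data.List using (_∷_; _++_)
  open import Data.List.Properties using (++-identityʳ)
  open import Data.Maybe using (Maybe; just; nothing)
  open import Data.Product using (Σ; _×_; _,_; ∃-syntax)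
  open import Data.Sum using (_⊎_; inj₁; inj₂)
  open import Relation.Binary.PropositionalEquality hiding ([_])
  open import Function using (_∘_)

  alternate : ∀ {X : Set} → (ℕ → X) → (ℕ → X) → ℕ → X
  alternate f g zero          = f 0
  alternate f g (suc zero)    = g 0
  alternate f g (suc (suc d)) = alternate (f ∘ suc) (g ∘ suc) d

  alternate-even : ∀ {X : Set} (f g : ℕ → X) t → alternate f g (t ℕ.* 2) ≡ f t
  alternate-even f g zero    = refl
  alternate-even f g (suc t) = alternate-even (f ∘ suc) (g ∘ suc) t

  alternate-odd : ∀ {X : Set} (f g : ℕ → X) t → alternate f g (suc (t ℕ.* 2)) ≡ g t
  alternate-odd f g zero    = refl
  alternate-odd f g (suc t) = alternate-odd (f ∘ suc) (g ∘ suc) t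

  Entry : Set
  Entry = ℕ → ℕ → Maybe ℤ

  -- Here and below the index maps `ι` and `κ` stay arbitrary, so that one computation serves rows
  -- (`ι` constant) and columns (`κ` constant).
  justs-append : ∀ (f g : ℕ → Entry) (ι κ : ℕ → ℕ) a b →
    justs (λ d → append a f g d (ι d) (κ d)) (a ℕ.+ b) ≡
    justs (λ d → f d (ι d) (κ d)) a ++ justs (λ d → g d (ι (a ℕ.+ d)) (κ (a ℕ.+ d))) b
  justs-append f g ι κ a b = trans (justs-++ _ a b refl) (cong₂ _++_
    (justs-cong a (λ {d} d<a → cong (λ e → e (ι d) (κ d)) (append-< f g d<a)))
    (justs-cong b (λ {d} _ → cong (λ e → e (ι (a ℕ.+ d)) (κ (a ℕ.+ d))) (append-+ a f g))))

  justs-alternate : ∀ (f g : ℕ → ℕ → ℤ) (ι κ : ℕ → ℕ) p →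
    justs (λ d → alternate (λ t _ j → just (f t j)) (λ t _ j → just (g t j)) d (ι d) (κ d))
      (p ℕ.* 2) ≡
    interleave (λ t → f t (κ (t ℕ.* 2))) (λ t → g t (κ (suc (t ℕ.* 2)))) p
  justs-alternate f g ι κ zero    = refl
  justs-alternate f g ι κ (suc p) = cong (λ l → _ ∷ _ ∷ l)
    (justs-alternate (f ∘ suc) (g ∘ suc) (λ d → ι (suc (suc d))) (λ d → κ (suc (suc d))) p)

  -- For `n = 4q + 1` the bound `4p + 3 ≤ n` means `p < q`; `s` is the surplus `q - p - 1`.
  module Construction (p : ℕ) (0<p : 0 < p) (s : ℕ) where

    q k : ℕ
    q = suc (p ℕ.+ s)
    k = 4 ℕ.* p ℕ.+ 3

    open Cyclic (4 ℕ.* q)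
    open Alpha q z<s

    -- Block `b` consists of bn + 1, ..., bn + n, addressed by an offset `r < n`.
    block : ℕ → ℕ → ℕ
    block b r = suc (b ℕ.* n ℕ.+ r)

    previous : ℕ → ℕ
    previous = diagonal 1

    -- Each `t` uses blocks 4t + 3 to 4t + 6, the two blocks of a pair being two apart. The second
    -- diagonal of a pair takes its offset from the previous column, so that both members of a pair
    -- have the same offset within a row.
    alphas gammas betas plus₁ minus₁ minus₂ plus₂ group₁ group₂ empty : ℕ → Entry
    alphas _ i j = just (α i)
    gammas _ i j = just (α ((i ℕ.+ u) % n) - K)
    betas  _ i j = just (β i j)
    plus₁  t i j = just (+ block (4 ℕ.* t ℕ.+ 3) j)
    minus₁ t i j = just (- + block (4 ℕ.* t ℕ.+ 5) (previous j))
    minus₂ t i j = just (- + block (4 ℕ.* t ℕ.+ 4) j)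
    plus₂  t i j = just (+ block (4 ℕ.* t ℕ.+ 6) (previous j))
    group₁ = alternate plus₁ minus₁
    group₂ = alternate minus₂ plus₂
    empty  _ i j = nothing

    -- The number `u - 2 - 2p` of empty diagonals before `u`; equally many remain after the second
    -- group.
    gap : ℕ
    gap = suc (s ℕ.* 2)

    T₁ T₂ T₃ T₄ T₅ T : ℕ → Entry
    T₅ = append (p ℕ.* 2) group₂ empty
    T₄ = append 1 betas T₅
    T₃ = append gap empty T₄
    T₂ = append (p ℕ.* 2) group₁ T₃
    T₁ = append 1 gammas T₂
    T  = append 1 alphas T₁

    -- Positions counted from diagonal 2 and from diagonal `u`.
    after₁ after₂ : ℕ → ℕ
    after₁ d = suc (suc d)
    after₂ d = after₁ (p ℕ.* 2 ℕ.+ (gap ℕ.+ d))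

    n≡ : after₂ (suc (p ℕ.* 2 ℕ.+ gap)) ≡ n
    n≡ = lem p s
      where
      lem : ∀ p s → suc (suc (p ℕ.* 2 ℕ.+ (suc (s ℕ.* 2) ℕ.+ suc (p ℕ.* 2 ℕ.+ suc (s ℕ.* 2)))))
        ≡ suc (4 ℕ.* suc (p ℕ.+ s))
      lem = ℕ-solve-∀

    u≡ : after₂ 0 ≡ u
    u≡ = lem p s
      where
      lem : ∀ p s → suc (suc (p ℕ.* 2 ℕ.+ (suc (s ℕ.* 2) ℕ.+ 0)))
        ≡ suc (suc (p ℕ.+ s) ℕ.+ suc (p ℕ.+ s))
      lem = ℕ-solve-∀

    justs-T : ∀ (ι κ : ℕ → ℕ) → justs (λ d → T d (ι d) (κ d)) n ≡
      α (ι 0) ∷ α ((ι 1 ℕ.+ u) % n) - K ∷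
      interleave (λ t → + block (4 ℕ.* t ℕ.+ 3) (κ (after₁ (t ℕ.* 2))))
        (λ t → - + block (4 ℕ.* t ℕ.+ 5) (previous (κ (after₁ (suc (t ℕ.* 2)))))) p
      ++ β (ι u) (κ u) ∷
      interleave (λ t → - + block (4 ℕ.* t ℕ.+ 4) (κ (after₂ (suc (t ℕ.* 2)))))
        (λ t → + block (4 ℕ.* t ℕ.+ 6) (previous (κ (after₂ (suc (suc (t ℕ.* 2))))))) p
    justs-T ι κ = begin
      justs (λ d → T d (ι d) (κ d)) n
        ≡⟨ cong (justs (λ d → T d (ι d) (κ d))) (sym n≡) ⟩
      justs (λ d → T d (ι d) (κ d)) (after₂ (suc (p ℕ.* 2 ℕ.+ gap)))
        ≡⟨ justs-append alphas T₁ ι κ 1 (suc rest) ⟩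
      α (ι 0) ∷ justs (λ d → T₁ d (ι (suc d)) (κ (suc d))) (suc rest)
        ≡⟨ cong (λ l → α (ι 0) ∷ l) (justs-append gammas T₂ (ι ∘ suc) (κ ∘ suc) 1 rest) ⟩
      α (ι 0) ∷ α ((ι 1 ℕ.+ u) % n) - K ∷
        justs (λ d → T₂ d (ι (after₁ d)) (κ (after₁ d))) rest
        ≡⟨ cong (λ l → α (ι 0) ∷ α ((ι 1 ℕ.+ u) % n) - K ∷ l) (begin
          justs (λ d → T₂ d (ι (after₁ d)) (κ (after₁ d))) rest
            ≡⟨ justs-append group₁ T₃ (ι ∘ after₁) (κ ∘ after₁) (p ℕ.* 2) _ ⟩
          justs (λ d → group₁ d (ι (after₁ d)) (κ (after₁ d))) (p ℕ.* 2) ++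
            justs (λ d → T₃ d (ι (after₁ (p ℕ.* 2 ℕ.+ d))) (κ (after₁ (p ℕ.* 2 ℕ.+ d))))
              (gap ℕ.+ suc (p ℕ.* 2 ℕ.+ gap))
            ≡⟨ cong₂ _++_ (justs-alternate _ _ (ι ∘ after₁) (κ ∘ after₁) p) (begin
              _ ≡⟨ justs-append empty T₄ (λ d → ι (after₁ (p ℕ.* 2 ℕ.+ d)))
                     (λ d → κ (after₁ (p ℕ.* 2 ℕ.+ d))) gap _ ⟩
              justs (λ d → empty d (ι (after₁ (p ℕ.* 2 ℕ.+ d))) (κ (after₁ (p ℕ.* 2 ℕ.+ d)))) gap ++
                justs (λ d → T₄ d (ι (after₂ d)) (κ (after₂ d))) (suc (p ℕ.* 2 ℕ.+ gap))
                ≡⟨ cong₂ _++_ (justs-nothing gap (λ _ → refl))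
                     (justs-append betas T₅ (ι ∘ after₂) (κ ∘ after₂) 1 (p ℕ.* 2 ℕ.+ gap)) ⟩
              β (ι (after₂ 0)) (κ (after₂ 0)) ∷
                justs (λ d → T₅ d (ι (after₂ (suc d))) (κ (after₂ (suc d)))) (p ℕ.* 2 ℕ.+ gap)
                ≡⟨ cong₂ (λ v l → β (ι v) (κ v) ∷ l) u≡ (justs-append group₂ empty
                     (ι ∘ after₂ ∘ suc) (κ ∘ after₂ ∘ suc) (p ℕ.* 2) gap) ⟩
              β (ι u) (κ u) ∷
                justs (λ d → group₂ d (ι (after₂ (suc d))) (κ (after₂ (suc d)))) (p ℕ.* 2) ++ _
                ≡⟨ cong (λ l → β (ι u) (κ u) ∷ l) (trans
                     (cong₂ _++_ (justs-alternate _ _ (ι ∘ after₂ ∘ suc) (κ ∘ after₂ ∘ suc) p)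
                       (justs-nothing gap (λ _ → refl)))
                     (++-identityʳ _)) ⟩
              _ ∎) ⟩
          _ ∎) ⟩
      _ ∎
      where
      open ≡-Reasoning
      rest : ℕ
      rest = p ℕ.* 2 ℕ.+ (gap ℕ.+ suc (p ℕ.* 2 ℕ.+ gap))

    m : ℕ
    m = suc (2 ℕ.* n ℕ.* k)

    -- Restates the conditions on a line in terms of offsets: the partner of an entry lies two
    -- blocks higher, hence `2n`, and the next pair four blocks higher, hence `4n`.
    zeroSumSimple : ∀ {a b c} D (x x′ y y′ : ℕ → ℕ) →
      n < D → D < 3 ℕ.* n → 1ℤ + n′ ≤ a → a + b ≤ + 3 * n′ → Small b → a + c ≡ - b →
      (∀ t → x t < n) → (∀ t → x′ t ℕ.+ 2 ℕ.* n ≡ x t ℕ.+ D) →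
      (∀ t → x t ℕ.+ D < x (suc t) ℕ.+ 4 ℕ.* n) →
      (∀ t → y t < n) → (∀ t → y′ t ℕ.+ 2 ℕ.* n ≡ y t ℕ.+ D) →
      (∀ t → y t ℕ.+ D < y (suc t) ℕ.+ 4 ℕ.* n) →
      ZeroSumSimple m k
        (a ∷ c ∷ interleave (λ t → + block (4 ℕ.* t ℕ.+ 3) (x t))
                   (λ t → - + block (4 ℕ.* t ℕ.+ 5) (x′ t)) p
        ++ b ∷ interleave (λ t → - + block (4 ℕ.* t ℕ.+ 4) (y t))
                 (λ t → + block (4 ℕ.* t ℕ.+ 6) (y′ t)) p)
    zeroSumSimple {a} {b} {c} D x x′ y y′ n<D D<3n n<a a+b≤3n ((-n≤b , b≤n) , b≢0) a+c≡-b
      x<n x′≡ x-step y<n y′≡ y-step =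
      subst (ZeroSumSimple m k)
        (cong₂ (λ l l′ → a ∷ c ∷ l ++ b ∷ l′)
          (interleave-cong p (λ t _ → refl) (λ t _ → cong (λ z → - + z) (partner t 3 (x′≡ t))))
          (interleave-cong p (λ t _ → refl)
            (λ t _ → trans (negated (+ Y t) (+ D)) (cong +_ (partner t 4 (y′≡ t))))))
        (Line.zeroSumSimple-line p 0<p (+ n) (+ D) a b c (λ t → + X t) (λ t → + Y t)
          (+≤+ z≤n) (+≤+ n<D) (subst (+ suc D ≤_) (pos-* 3 n) (+≤+ D<3n))
          (subst (λ z → 1ℤ + z ≤ a) (sym +n≡n′) n<a)
          (subst (λ z → a + b ≤ + 3 * z) (sym +n≡n′) a+b≤3n)
          (subst (λ z → - z ≤ b) (sym +n≡n′) -n≤b) (subst (b ≤_) (sym +n≡n′) b≤n) b≢0 a+c≡-b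
          (λ t → +≤+ (step t 3 (x-step t)))
          (subst (λ z → 1ℤ + z ≤ + X 0) (pos-* 3 n) (+≤+ (s≤s (ℕₚ.m≤m+n (3 ℕ.* n) (x 0)))))
          (λ t → subst (+ X t ≤_)
            (trans (pos-* (suc t) (4 ℕ.* n)) (cong (λ z → + suc t * z) (pos-* 4 n)))
            (+≤+ (upper t 3 (suc t ℕ.* (4 ℕ.* n)) (x<n t) (x-top n t))))
          (λ t → +≤+ (step t 4 (y-step t)))
          (+≤+ (s≤s (subst (n ℕ.≤_) (y-bottom n (y 0)) (ℕₚ.m≤m+n n _))))
          (λ t → subst (+ Y t ≤_)
            (trans (pos-* (4 ℕ.* t ℕ.+ 5) n) (cong (λ z → (z + + 5) * + n) (pos-* 4 t)))
            (+≤+ (upper t 4 _ (y<n t) (y-top n t))))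
          m modulus)
      where
      X Y : ℕ → ℕ
      X t = block (4 ℕ.* t ℕ.+ 3) (x t)
      Y t = block (4 ℕ.* t ℕ.+ 4) (y t)
      partner : ∀ t b {r r′} → r′ ℕ.+ 2 ℕ.* n ≡ r ℕ.+ D →
        block (4 ℕ.* t ℕ.+ b) r ℕ.+ D ≡ block (4 ℕ.* t ℕ.+ (2 ℕ.+ b)) r′
      partner t b {r} {r′} eq = trans (ℕₚ.+-assoc (suc ((4 ℕ.* t ℕ.+ b) ℕ.* n)) r D)
        (trans (cong (suc ((4 ℕ.* t ℕ.+ b) ℕ.* n) ℕ.+_) (sym eq)) (lem n t b r′))
        where
        lem : ∀ n t b r → suc ((4 ℕ.* t ℕ.+ b) ℕ.* n) ℕ.+ (r ℕ.+ 2 ℕ.* n)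
          ≡ suc ((4 ℕ.* t ℕ.+ (2 ℕ.+ b)) ℕ.* n ℕ.+ r)
        lem = ℕ-solve-∀
      step : ∀ t b {r r′} → r ℕ.+ D < r′ ℕ.+ 4 ℕ.* n →
        block (4 ℕ.* t ℕ.+ b) r ℕ.+ D < block (4 ℕ.* suc t ℕ.+ b) r′
      step t b {r} {r′} r+D< = subst₂ _<_
        (sym (ℕₚ.+-assoc (suc ((4 ℕ.* t ℕ.+ b) ℕ.* n)) r D)) (lem n t b r′)
        (ℕₚ.+-monoʳ-< (suc ((4 ℕ.* t ℕ.+ b) ℕ.* n)) r+D<)
        where
        lem : ∀ n t b r → suc ((4 ℕ.* t ℕ.+ b) ℕ.* n) ℕ.+ (r ℕ.+ 4 ℕ.* n)
          ≡ suc ((4 ℕ.* suc t ℕ.+ b) ℕ.* n ℕ.+ r)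
        lem = ℕ-solve-∀
      upper : ∀ t b {r} top → r < n → (4 ℕ.* t ℕ.+ b) ℕ.* n ℕ.+ n ≡ top →
        block (4 ℕ.* t ℕ.+ b) r ℕ.≤ top
      upper t b top r<n refl = ℕₚ.+-monoʳ-< ((4 ℕ.* t ℕ.+ b) ℕ.* n) r<n
      x-top : ∀ n t → (4 ℕ.* t ℕ.+ 3) ℕ.* n ℕ.+ n ≡ suc t ℕ.* (4 ℕ.* n)
      x-top = ℕ-solve-∀
      y-top : ∀ n t → (4 ℕ.* t ℕ.+ 4) ℕ.* n ℕ.+ n ≡ (4 ℕ.* t ℕ.+ 5) ℕ.* n
      y-top = ℕ-solve-∀
      y-bottom : ∀ n y → n ℕ.+ (3 ℕ.* n ℕ.+ y) ≡ 4 ℕ.* n ℕ.+ y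
      y-bottom = ℕ-solve-∀
      negated : ∀ y D → - (- y + - D) ≡ y + D
      negated = solve-∀
      modulus : + m ≡ 1ℤ + + 2 * + n * (+ 4 * + p + + 3)
      modulus = cong (λ z → 1ℤ + z) (trans (pos-* (2 ℕ.* n) k)
        (cong₂ _*_ (pos-* 2 n) (cong (λ z → z + + 3) (pos-* 4 p))))

    open Diagonals T

    1<n : 1 < n
    1<n = s<s z<s

    previous-suc : ∀ i → previous (suc i % n) ≡ i % n
    previous-suc i = trans (cong previous (trans (ℕ.%-distribˡ-+ 1 i n)
        (cong (λ z → (z ℕ.+ i % n) % n) (ℕ.m<n⇒m%n≡m 1<n))))
      (diagonal-% 1<n (ℕ.m%n<n i n))

    β-sum : ∀ a a′ → a + (a′ - K) ≡ - (K - a - a′)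
    β-sum a a′ = lem a a′ K
      where
      lem : ∀ a a′ K → a + (a′ - K) ≡ - (K - a - a′)
      lem = solve-∀

    β-sum′ : ∀ a a′ → a + (a′ - K) ≡ - (K - a′ - a)
    β-sum′ a a′ = lem a a′ K
      where
      lem : ∀ a a′ K → a + (a′ - K) ≡ - (K - a′ - a)
      lem = solve-∀

    -- The hypothesis makes `b` equal to `K - a - a′`, so `a + b = K - a′ ≤ (4n + 1) - (n + 1)`.
    α+β≤3n : ∀ {a a′ b} → 1ℤ + n′ ≤ a′ → a + (a′ - K) ≡ - b → a + b ≤ + 3 * n′
    α+β≤3n {a} {a′} {b} n<a′ eq = ≤-by (diff n<a′) (trans (lem₁ a a′ (+ q))
      (trans (cong (λ z → + 3 * n′ - a + z) eq) (lem₂ n′ a b)))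
      where
      lem₁ : ∀ a a′ Q → a′ - (1ℤ + (+ 4 * Q + 1ℤ))
        ≡ + 3 * (+ 4 * Q + 1ℤ) - a + (a + (a′ - (+ 16 * Q + + 5)))
      lem₁ = solve-∀
      lem₂ : ∀ n a b → + 3 * n - a + - b ≡ + 3 * n - (a + b)
      lem₂ = solve-∀

    step-bound : ∀ {r D} r′ → r < n → D ℕ.≤ 3 ℕ.* n → r ℕ.+ D < r′ ℕ.+ 4 ℕ.* n
    step-bound r′ r<n D≤3n = ℕₚ.<-≤-trans (ℕₚ.+-mono-<-≤ r<n D≤3n) (ℕₚ.m≤n+m (4 ℕ.* n) r′)

    after₂-suc : ∀ d → after₂ (suc d) ≡ suc (after₂ d)
    after₂-suc d = lem (p ℕ.* 2) gap d
      where
      lem : ∀ a b d → suc (suc (a ℕ.+ (b ℕ.+ suc d))) ≡ suc (suc (suc (a ℕ.+ (b ℕ.+ d))))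
      lem = ℕ-solve-∀

    rows : ∀ {i} → i < n → ZeroSumSimple m k (rowLine i)
    rows {i} i<n = subst (ZeroSumSimple m k) (sym (justs-T (λ _ → i) κ))
      -- Equal offsets in blocks two apart give the difference `2n` for every pair of the row.
      (zeroSumSimple {α i} {c = α i⁺ - K} (2 ℕ.* n) x x′ y y′
        (ℕₚ.m<m+n n z<s) (ℕₚ.m<n+m (2 ℕ.* n) {n} z<s) (α-lower i<n)
        (α+β≤3n {α i} {α i⁺} (α-lower i⁺<n) (β-sum (α i) (α i⁺)))
        (β-small (shift i<n)) (β-sum (α i) (α i⁺))
        x<n (λ t → partner (after₁ (t ℕ.* 2))) (λ t → step-bound (x (suc t)) (x<n t) 2n≤3n)
        y<n (λ t → subst (λ d → previous (κ d) ℕ.+ 2 ℕ.* n ≡ y t ℕ.+ 2 ℕ.* n)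
          (sym (after₂-suc (suc (t ℕ.* 2)))) (partner (after₂ (suc (t ℕ.* 2)))))
        (λ t → step-bound (y (suc t)) (y<n t) 2n≤3n))
      where
      κ x x′ y y′ : ℕ → ℕ
      κ d = (i ℕ.+ d) % n
      x  t = κ (after₁ (t ℕ.* 2))
      x′ t = previous (κ (after₁ (suc (t ℕ.* 2))))
      y  t = κ (after₂ (suc (t ℕ.* 2)))
      y′ t = previous (κ (after₂ (suc (suc (t ℕ.* 2)))))
      i⁺ : ℕ
      i⁺ = (i ℕ.+ u) % n
      i⁺<n : i⁺ < n
      i⁺<n = ℕ.m%n<n (i ℕ.+ u) n
      x<n : ∀ t → x t < n
      x<n t = ℕ.m%n<n (i ℕ.+ after₁ (t ℕ.* 2)) n
      y<n : ∀ t → y t < n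
      y<n t = ℕ.m%n<n (i ℕ.+ after₂ (suc (t ℕ.* 2))) n
      2n≤3n : 2 ℕ.* n ℕ.≤ 3 ℕ.* n
      2n≤3n = ℕₚ.m≤n+m (2 ℕ.* n) n
      partner : ∀ d → previous (κ (suc d)) ℕ.+ 2 ℕ.* n ≡ κ d ℕ.+ 2 ℕ.* n
      partner d = cong (ℕ._+ 2 ℕ.* n)
        (trans (cong (λ z → previous (z % n)) (ℕₚ.+-suc i d)) (previous-suc (i ℕ.+ d)))

    u<n : u < n
    u<n = subst (λ z → z < n) u≡ (subst (after₂ 0 <_) n≡
      (s≤s (s≤s (ℕₚ.+-monoʳ-< (p ℕ.* 2) (ℕₚ.+-monoʳ-< gap z<s)))))

    -- Diagonals 0, 1 and u carry the three-diagonal part because 2u ≡ 1 (mod n).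
    diagonal-u : ∀ {j} → j < n → (diagonal 1 j ℕ.+ u) % n ≡ diagonal u j
    diagonal-u {j} j<n = begin
      i                                ≡⟨ diagonal-% u<n (ℕ.m%n<n (diagonal 1 j ℕ.+ u) n) ⟨
      diagonal u ((u ℕ.+ i) % n)       ≡⟨ cong (diagonal u) (begin
        (u ℕ.+ i) % n                    ≡⟨ ℕ.%-distribˡ-+ u i n ⟩
        (u % n ℕ.+ i % n) % n            ≡⟨ cong (λ z → (u % n ℕ.+ z) % n)
                                             (ℕ.m%n%n≡m%n (diagonal 1 j ℕ.+ u) n) ⟩
        (u % n ℕ.+ i) % n                ≡⟨ ℕ.%-distribˡ-+ u (diagonal 1 j ℕ.+ u) n ⟨
        (u ℕ.+ (diagonal 1 j ℕ.+ u)) % n ≡⟨ cong (_% n) (lem q (diagonal 1 j)) ⟩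
        (diagonal 1 j ℕ.+ 1 ℕ.+ n) % n   ≡⟨ ℕ.[m+n]%n≡m%n (diagonal 1 j ℕ.+ 1) n ⟩
        (diagonal 1 j ℕ.+ 1) % n         ≡⟨ diagonal-+% 1<n j<n ⟩
        j ∎) ⟩
      diagonal u j                     ∎
      where
      open ≡-Reasoning
      i : ℕ
      i = (diagonal 1 j ℕ.+ u) % n
      lem : ∀ q d → suc (q ℕ.+ q) ℕ.+ (d ℕ.+ suc (q ℕ.+ q)) ≡ d ℕ.+ 1 ℕ.+ suc (4 ℕ.* q)
      lem = ℕ-solve-∀

    -- The first of two paired diagonals increases with the column, so a pair contributes one
    -- constant to every column but column 0, where the second diagonal wraps around.
    columnGap : ∀ {j} → j < n →
      ∃[ D ] n < D × D < 3 ℕ.* n × previous j ℕ.+ 2 ℕ.* n ≡ j ℕ.+ D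
    -- Column 0 is preceded by column `n - 1 = 4q`, so its difference is `3n - 1`; in every other
    -- column the offset falls by one and the difference is `2n - 1`.
    columnGap {zero} _ = 4 ℕ.* q ℕ.+ 2 ℕ.* n ,
      ℕₚ.<-≤-trans (ℕₚ.m<m+n n z<s) (ℕₚ.m≤n+m (2 ℕ.* n) (4 ℕ.* q)) , ℕₚ.≤-refl ,
      cong (ℕ._+ 2 ℕ.* n) (diagonal-wrap {1} (ℕₚ.n<1+n (4 ℕ.* q)) (sym (ℕₚ.+-identityʳ n)))
    columnGap {suc j} j<n = 4 ℕ.* q ℕ.+ n ,
      ℕₚ.m<n+m n z<s , ℕₚ.+-monoʳ-≤ n (ℕₚ.m≤m+n n (n ℕ.+ 0)) ,
      trans (cong (ℕ._+ 2 ℕ.* n) (diagonal-+ 1 (ℕₚ.<-trans (ℕₚ.n<1+n j) j<n))) (lem j (4 ℕ.* q))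
      where
      lem : ∀ j N → j ℕ.+ 2 ℕ.* suc N ≡ suc j ℕ.+ (N ℕ.+ suc N)
      lem = ℕ-solve-∀

    cols : ∀ {j} → j < n → ZeroSumSimple m k (colLine j)
    cols {j} j<n with columnGap j<n
    ... | D , n<D , D<3n , partner = subst (ZeroSumSimple m k)
      (sym (trans (justs-T (λ d → diagonal d j) (λ _ → j))
        (heads (diagonal-+ 0 j<n) (diagonal-u j<n))))
      (zeroSumSimple {α j} {c = α i - K} D (λ _ → j) (λ _ → previous j) (λ _ → j) (λ _ → previous j)
        n<D D<3n (α-lower j<n) (α+β≤3n {α j} {α i} (α-lower i<n) (β-sum′ (α j) (α i)))
        -- `i` is the row in which diagonal `u` meets column `j`, so `i + u ≡ j` modulo `n`, and the
        -- two `α` values exchange their roles compared with a row.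
        (β-small (subst (Shifted i) (diagonal-+% u<n j<n) (shift i<n))) (β-sum′ (α j) (α i))
        (λ _ → j<n) (λ _ → partner) (λ _ → step-bound j j<n (ℕₚ.<⇒≤ D<3n))
        (λ _ → j<n) (λ _ → partner) (λ _ → step-bound j j<n (ℕₚ.<⇒≤ D<3n)))
      where
      heads : ∀ {i i₀ i′ i′₀ l} → i ≡ i₀ → i′ ≡ i′₀ →
        α i ∷ α i′ - K ∷ l ≡ α i₀ ∷ α i′₀ - K ∷ l
      heads refl refl = refl
      i : ℕ
      i = diagonal u j
      i<n : i < n
      i<n = diagonal<n u j

    Occurs : ℕ → Set
    Occurs x = ∃[ d ] ∃[ i ] i < n × d < n ×
      (T d i ((i ℕ.+ d) % n) ≡ just (+ x) ⊎ T d i ((i ℕ.+ d) % n) ≡ just (- + x))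

    -- Numbers above 3n are placed by column, so the cell is named by diagonal and column and its
    -- row recovered.
    occurs-at : ∀ {x} d j → d < n → j < n →
      T d (diagonal d j) j ≡ just (+ x) ⊎ T d (diagonal d j) j ≡ just (- + x) → Occurs x
    occurs-at {x} d j d<n j<n found = d , diagonal d j , diagonal<n d j , d<n ,
      subst (λ z → T d (diagonal d j) z ≡ just (+ x) ⊎ T d (diagonal d j) z ≡ just (- + x))
        (sym (diagonal-+% d<n j<n)) found

    T-after₁ : ∀ {d} → d < p ℕ.* 2 → T (after₁ d) ≡ group₁ d
    T-after₁ d<2p = append-< group₁ T₃ d<2p

    T-after₂ : ∀ d → T (after₂ d) ≡ T₄ d
    T-after₂ d = trans (append-+ (p ℕ.* 2) group₁ T₃) (append-+ gap empty T₄)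

    T-u : T u ≡ betas 0
    T-u = trans (cong T (sym u≡)) (T-after₂ 0)

    T-after₂-suc : ∀ {d} → d < p ℕ.* 2 → T (after₂ (suc d)) ≡ group₂ d
    T-after₂-suc d<2p = trans (T-after₂ _) (append-< group₂ empty d<2p)

    after₂-suc<n : ∀ {d} → d < p ℕ.* 2 → after₂ (suc d) < n
    after₂-suc<n {d} d<2p = subst (after₂ (suc d) <_) n≡
      (s≤s (s≤s (ℕₚ.+-monoʳ-< (p ℕ.* 2) (ℕₚ.+-monoʳ-< gap
        (s≤s (ℕₚ.<-≤-trans d<2p (ℕₚ.m≤m+n (p ℕ.* 2) gap)))))))

    after₁<n : ∀ {d} → d < p ℕ.* 2 → after₁ d < n
    after₁<n {d} d<2p = subst (after₁ d <_) n≡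
      (s≤s (s≤s (ℕₚ.<-≤-trans d<2p (ℕₚ.m≤m+n (p ℕ.* 2) _))))

    occurs-small : ∀ {y} → y < n → Occurs (suc y)
    occurs-small y<n with β-covers y<n
    ... | i , i<n , inj₁ eq = u , i , i<n , u<n ,
      inj₁ (trans (cong (λ e → e i ((i ℕ.+ u) % n)) T-u) (cong just eq))
    ... | i , i<n , inj₂ eq = u , i , i<n , u<n ,
      inj₂ (trans (cong (λ e → e i ((i ℕ.+ u) % n)) T-u) (cong just eq))

    occurs-medium : ∀ {y} → y < n ℕ.+ n → Occurs (suc n ℕ.+ y)
    occurs-medium y<2n with α-covers y<2n
    ... | i , i<n , inj₁ eq = 0 , i , i<n , z<s , inj₁ (cong just eq)
    -- The second diagonal carries `α` shifted by `u`, so the value `α i - K` stands in row `i - u`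
    -- modulo `n`.
    ... | i , i<n , inj₂ eq = 1 , diagonal u i , diagonal<n u i , 1<n ,
      inj₂ (cong just (trans (cong (λ z → α z - K) (diagonal-+% u<n i<n)) eq))

    previous-suc-< : ∀ {r} → r < n → previous (suc r % n) ≡ r
    previous-suc-< {r} r<n = trans (previous-suc r) (ℕ.m<n⇒m%n≡m r<n)

    -- The values 0, 1, 2, 3 of `c` belong to `plus₁`, `minus₂`, `minus₁`, `plus₂` in this order.
    occurs-block : ∀ {t c r} → t < p → c < 4 → r < n → Occurs (block (c ℕ.+ t ℕ.* 4 ℕ.+ 3) r)
    occurs-block {t} {c} {r} t<p c<4 r<n = by-residue c c<4
      where
      odd : suc (t ℕ.* 2) < p ℕ.* 2
      odd = ℕₚ.*-monoˡ-≤ 2 t<p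
      even : t ℕ.* 2 < p ℕ.* 2
      even = ℕₚ.<-trans (ℕₚ.n<1+n _) odd
      -- On the second diagonal of a pair the offset is the previous column, so offset `r` is found
      -- in column `r + 1` modulo `n`.
      j : ℕ
      j = suc r % n
      j<n : j < n
      j<n = ℕ.m%n<n (suc r) n
      entry : ∀ {e e′ : Entry} d j → e ≡ e′ → e (diagonal d j) j ≡ e′ (diagonal d j) j
      entry d j = cong (λ e → e (diagonal d j) j)
      by-residue : ∀ c → c < 4 → Occurs (block (c ℕ.+ t ℕ.* 4 ℕ.+ 3) r)
      by-residue 0 _ = occurs-at d r (after₁<n even) r<n
        (inj₁ (trans (entry d r (trans (T-after₁ even) (alternate-even plus₁ minus₁ t)))
          (cong (λ b → just (+ block b r)) (lem t))))
        where
        d = after₁ (t ℕ.* 2)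
        lem : ∀ t → 4 ℕ.* t ℕ.+ 3 ≡ t ℕ.* 4 ℕ.+ 3
        lem = ℕ-solve-∀
      by-residue 1 _ = occurs-at d r (after₂-suc<n even) r<n
        (inj₂ (trans (entry d r (trans (T-after₂-suc even) (alternate-even minus₂ plus₂ t)))
          (cong (λ b → just (- + block b r)) (lem t))))
        where
        d = after₂ (suc (t ℕ.* 2))
        lem : ∀ t → 4 ℕ.* t ℕ.+ 4 ≡ 1 ℕ.+ t ℕ.* 4 ℕ.+ 3
        lem = ℕ-solve-∀
      by-residue 2 _ = occurs-at d j (after₁<n odd) j<n
        (inj₂ (trans (entry d j (trans (T-after₁ odd) (alternate-odd plus₁ minus₁ t)))
          (cong₂ (λ b r → just (- + block b r)) (lem t) (previous-suc-< r<n))))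
        where
        d = after₁ (suc (t ℕ.* 2))
        lem : ∀ t → 4 ℕ.* t ℕ.+ 5 ≡ 2 ℕ.+ t ℕ.* 4 ℕ.+ 3
        lem = ℕ-solve-∀
      by-residue 3 _ = occurs-at d j (after₂-suc<n odd) j<n
        (inj₁ (trans (entry d j (trans (T-after₂-suc odd) (alternate-odd minus₂ plus₂ t)))
          (cong₂ (λ b r → just (+ block b r)) (lem t) (previous-suc-< r<n))))
        where
        d = after₂ (suc (suc (t ℕ.* 2)))
        lem : ∀ t → 4 ℕ.* t ℕ.+ 6 ≡ 3 ℕ.+ t ℕ.* 4 ℕ.+ 3
        lem = ℕ-solve-∀
      by-residue (suc (suc (suc (suc _)))) (s≤s (s≤s (s≤s (s≤s ()))))

    covers : ∀ x → 1 ℕ.≤ x → x ℕ.≤ n ℕ.* k → Occurs x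
    covers (suc y) _ y<nk with split< n y
    ... | inj₁ y<n = occurs-small y<n
    ... | inj₂ (y , refl) with split< (n ℕ.+ n) y
    ...   | inj₁ y<2n = occurs-medium y<2n
    ...   | inj₂ (z , refl) = subst Occurs x≡ (occurs-block t<p (ℕ.m%n<n b 4) (ℕ.m%n<n z n))
      where
      -- The number is `3n + 1 + z`, hence lies in block `b + 3`; the quotient `t` of `b` by 4
      -- selects the pair and the remainder its diagonal.
      b t : ℕ
      b = z / n
      t = b / 4
      z<4pn : z < p ℕ.* 4 ℕ.* n
      z<4pn = ℕₚ.+-cancelˡ-< (n ℕ.+ (n ℕ.+ n)) z _
        (subst₂ _<_ (sym (ℕₚ.+-assoc n (n ℕ.+ n) z)) (lem n p) y<nk)
        where
        lem : ∀ n p → n ℕ.* (4 ℕ.* p ℕ.+ 3) ≡ n ℕ.+ (n ℕ.+ n) ℕ.+ p ℕ.* 4 ℕ.* n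
        lem = ℕ-solve-∀
      t<p : t < p
      t<p = ℕ.m<n*o⇒m/o<n (ℕ.m<n*o⇒m/o<n z<4pn)
      x≡ : block (b % 4 ℕ.+ t ℕ.* 4 ℕ.+ 3) (z % n) ≡ suc (n ℕ.+ (n ℕ.+ n ℕ.+ z))
      x≡ = begin
        suc ((b % 4 ℕ.+ t ℕ.* 4 ℕ.+ 3) ℕ.* n ℕ.+ z % n)
          ≡⟨ cong (λ b → suc ((b ℕ.+ 3) ℕ.* n ℕ.+ z % n)) (ℕ.m≡m%n+[m/n]*n b 4) ⟨
        suc ((b ℕ.+ 3) ℕ.* n ℕ.+ z % n)
          ≡⟨ lem b n (z % n) ⟩
        suc (n ℕ.+ (n ℕ.+ n ℕ.+ (z % n ℕ.+ b ℕ.* n)))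
          ≡⟨ cong (λ z → suc (n ℕ.+ (n ℕ.+ n ℕ.+ z))) (ℕ.m≡m%n+[m/n]*n z n) ⟨
        suc (n ℕ.+ (n ℕ.+ n ℕ.+ z)) ∎
        where
        open ≡-Reasoning
        lem : ∀ b n r → suc ((b ℕ.+ 3) ℕ.* n ℕ.+ r) ≡ suc (n ℕ.+ (n ℕ.+ n ℕ.+ (r ℕ.+ b ℕ.* n)))
        lem = ℕ-solve-∀

    heffterArray : Σ (Array n) (λ A → IsIntegerHeffter n k A × IsGloballySimple n k A)
    heffterArray = array , heffter k rows cols covers

-- Reduction to the parameters `p` and `s`.

import Data.Nat.Properties as ℕₚ
import Data.Nat.DivMod as ℕ
open import Data.Nat using (ℕ; suc; _+_; _*_; _%_; _/_; _≤_; _<_; s<s; z<s)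
open import Data.Product using (Σ; _×_; _,_)
open import Relation.Binary.PropositionalEquality

theorem1p6 : (n p : ℕ) → n % 4 ≡ 1 → 0 < p → 4 * p + 3 ≤ n →
    Σ (Array n) (λ A → IsIntegerHeffter n (4 * p + 3) A × IsGloballySimple n (4 * p + 3) A)
theorem1p6 n p n%4≡1 0<p k≤n with ℕₚ.m≤n⇒∃[o]m+o≡n p<q
  where
  -- With `q = n / 4` and `n = 4q + 1`, the bound gives `4p + 1 < 4p + 3 ≤ 4q + 1`.
  p<q : p < n / 4
  p<q = ℕₚ.*-cancelˡ-< 4 p (n / 4) (ℕₚ.+-cancelʳ-< 1 (4 * p) _ (begin-strict
    4 * p + 1          <⟨ ℕₚ.+-monoʳ-< (4 * p) (s<s z<s) ⟩
    4 * p + 3          ≤⟨ k≤n ⟩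
    n                  ≡⟨ ℕ.m≡m%n+[m/n]*n n 4 ⟩
    n % 4 + n / 4 * 4  ≡⟨ cong₂ _+_ n%4≡1 (ℕₚ.*-comm (n / 4) 4) ⟩
    1 + 4 * (n / 4)    ≡⟨ ℕₚ.+-comm 1 (4 * (n / 4)) ⟩
    4 * (n / 4) + 1    ∎))
    where open ℕₚ.≤-Reasoning
... | s , 1+p+s≡q = subst (λ n → Σ (Array n) (λ A →
    IsIntegerHeffter n (4 * p + 3) A × IsGloballySimple n (4 * p + 3) A))
  n≡ (Arrays.Construction.heffterArray p 0<p s)
  where
  n≡ : suc (4 * suc (p + s)) ≡ n
  n≡ = trans (cong (λ q → suc (4 * q)) 1+p+s≡q) (sym (trans (ℕ.m≡m%n+[m/n]*n n 4)
    (cong₂ _+_ n%4≡1 (ℕₚ.*-comm (n / 4) 4))))
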